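{- Let $d\ge 1$ and $\mu\ge 1$. For every Any Fit packing algorithm $\mathcal{A}$ for the MinUsageTime Dynamic Vector Bin Packing problem in $d$ dimensions, the competitive ratio of $\mathcal{A}$ is at least $(\mu+1)d$; i.e., for every $\delta>0$ there is an instance $\mathcal{R}$ whose ratio of maximum to minimum item duration is $\mu$ such that $\mathsf{cost}(\mathcal{A},\mathcal{R}) \ge ((\mu+1)d-\delta)\,\mathsf{OPT}(\mathcal{R})$.
   Context: MinUsageTime Dynamic Vector Bin Packing (non-clairvoyant, online, no repacking): an instance is a finite list $\mathcal{R}$ of items; each item $r$ has arrival time $a(r)\ge 0$, departure time $e(r)>a(r)$, and size $\mathbf{s}(r)\in[0,1]^d$. Its active interval is $I(r)=[a(r),e(r))$ with duration $e(r)-a(r)$. Bins have capacity $1$ in each of the $d$ coordinates. Items are revealed in order of arrival (ties in a given order); on arrival, an item must be irrevocably placed into a bin such that the total size of items currently active in that bin stays $\le 1$ in every coordinate; the departure time is unknown at arrival. A bin is open while it contains an active item; once all its items have departed it is closed and never used again. If bin $B_i$ receives item set $R_i$, the cost of algorithm $\mathcal{A}$ is $\mathsf{cost}(\mathcal{A},\mathcal{R})=\sum_i \mathrm{span}(R_i)$, where $\mathrm{span}(S)$ is the Lebesgue measure of $\bigcup_{r\in S} I(r)$. $\mathsf{OPT}(\mathcal{R})=\int \mathsf{OPT}(\mathcal{R},t)\,dt$, where $\mathsf{OPT}(\mathcal{R},t)$ is the minimum number of unit-capacity bins into which the items active at time $t$ can be packed (offline, repacking allowed). An Any Fit packing algorithm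 is any online algorithm of this form that opens a new bin for an arriving item only when the item cannot be accommodated in any currently open bin (the choice among open bins that fit is arbitrary).
   Formalization: The duration ratio μ (and δ) is taken rational rather than real, and the item arrival times, departure times and sizes, as well as the algorithm's inputs, are rational. -}

module Defs where

open import Data.Bool using (Bool; true; false; if_then_else_; _∧_; _∨_; not)
open import Data.Nat as ℕ using (ℕ; zero; suc)
open import Data.Integer using (+_)
open import Data.Rational as ℚ using (ℚ; 0ℚ; 1ℚ; _+_; _-_; _*_; _≤_; _<_; _/_; _≤ᵇ_)
open import Data.Rational.Properties using () renaming (_≟_ to _≟ℚ_)
open import Data.Bool.ListAction using (any)
open import Data.Maybe using (Maybe; just; nothing)
open import Data.Product using (_×_; _,_; ∃; proj₁; proj₂)
open import Data.List as List using (List; []; _∷_; _++_; [_]; map; filter; foldr; length; zip; deduplicate)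
open import Data.List.Membership.Propositional using (_∈_)
open import Data.List.Relation.Unary.Linked using (Linked)
open import Data.Vec as Vec using (Vec)
open import Relation.Nullary.Decidable using (⌊_⌋)
open import Relation.Binary.PropositionalEquality using (_≡_)

ℕ→ℚ : ℕ → ℚ
ℕ→ℚ n = (+ n) / 1

sumℚ : List ℚ → ℚ
sumℚ = foldr _+_ 0ℚ

_<ᵇ_ : ℚ → ℚ → Bool
p <ᵇ q = not (q ≤ᵇ p)

record Item (d : ℕ) : Set where
  constructor item
  field
    arr  : ℚ
    dep  : ℚ
    size : Vec ℚ d
open Item public

Instance : ℕ → Set
Instance d = List (Item d)

duration : ∀ {d} → Item d → ℚ
duration r = dep r - arr r

activeᵇ : ∀ {d} → ℚ → Item d → Bool
activeᵇ t r = (arr r ≤ᵇ t) ∧ (t <ᵇ dep r)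

ValidItem : ∀ {d} → Item d → Set
ValidItem r = (0ℚ ≤ arr r) × (arr r < dep r)
            × VAll.All (λ x → (0ℚ ≤ x) × (x ≤ 1ℚ)) (size r)
  where import Data.Vec.Relation.Unary.All as VAll

-- the list order is the order of revelation: nondecreasing arrivals
ValidInstance : ∀ {d} → Instance d → Set
ValidInstance R = LAll.All ValidItem R × Linked (λ r r′ → arr r ≤ arr r′) R
  where import Data.List.Relation.Unary.All as LAll

nextAbove : List ℚ → ℚ → Maybe ℚ
nextAbove []       p = nothing
nextAbove (q ∷ qs) p with nextAbove qs p
... | nothing = if p <ᵇ q then just q else nothing
... | just m  = if p <ᵇ q then (if q <ᵇ m then just q else just m) else just m

gap : List ℚ → ℚ → ℚ
gap ps p with nextAbove ps p
... | nothing = 0ℚ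
... | just q  = q - p

-- ∫ f dt, for f that is constant on each [p, next p) and 0 outside
-- [min ps, max ps)
integrate : List ℚ → (ℚ → ℚ) → ℚ
integrate ps f = sumℚ (map (λ p → gap qs p * f p) qs)
  where qs = deduplicate _≟ℚ_ ps

endpoints : ∀ {d} → Instance d → List ℚ
endpoints R = List.concatMap (λ r → arr r ∷ dep r ∷ []) R

span : ∀ {d} → Instance d → ℚ
span S = integrate (endpoints S)
                   (λ t → if any (activeᵇ t) S then 1ℚ else 0ℚ)

zeroV : ∀ {d} → Vec ℚ d
zeroV = Vec.replicate _ 0ℚ

addV : ∀ {d} → Vec ℚ d → Vec ℚ d → Vec ℚ d
addV = Vec.zipWith _+_

leq1ᵇ : ∀ {d} → Vec ℚ d → Bool
leq1ᵇ v = Vec.foldr _ (λ x b → (x ≤ᵇ 1ℚ) ∧ b) true v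

inserts : ∀ {d} → Vec ℚ d → List (Vec ℚ d) → List (List (Vec ℚ d))
inserts s [] = []
inserts s (l ∷ ls) =
  (if leq1ᵇ (addV l s) then [ addV l s ∷ ls ] else [])
  ++ map (l ∷_) (inserts s ls)

packᵇ : ∀ {d} → List (Vec ℚ d) → List (Vec ℚ d) → Bool
packᵇ []       loads = true
packᵇ (s ∷ ss) loads = any (packᵇ ss) (inserts s loads)

searchBins : ∀ {d} → List (Vec ℚ d) → ℕ → ℕ → ℕ
searchBins L k zero    = k
searchBins L k (suc n) =
  if packᵇ L (List.replicate k zeroV) then k else searchBins L (suc k) n

-- minimum number of unit bins for a list of sizes (length L bins suffice)
minBins : ∀ {d} → List (Vec ℚ d) → ℕ
minBins L = searchBins L 0 (length L)

OPTat : ∀ {d} → Instance d → ℚ → ℕ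
OPTat R t = minBins (map size (filter (λ r → activeᵇ t r Data.Bool.≟ true) R))
  where import Data.Bool

OPT : ∀ {d} → Instance d → ℚ
OPT R = integrate (endpoints R) (λ t → ℕ→ℚ (OPTat R t))

observe : ∀ {d} → ℚ → Item d → ℚ × Vec ℚ d × Maybe ℚ
observe t r = arr r , size r , (if dep r ≤ᵇ t then just (dep r) else nothing)

-- an online algorithm maps (observed history, arrival and size of the new
-- item) to a bin label; bins are identified by natural-number labels
Alg : ℕ → Set
Alg d = List (ℚ × Vec ℚ d × Maybe ℚ) → ℚ × Vec ℚ d → ℕ

choose : ∀ {d} → Alg d → Instance d → Item d → ℕ
choose A past r = A (map (observe (arr r)) past) (arr r , size r)

labelsFrom : ∀ {d} → Alg d → Instance d → Instance d → List ℕ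
labelsFrom A past []       = []
labelsFrom A past (r ∷ rs) = choose A past r ∷ labelsFrom A (past ++ [ r ]) rs

labels : ∀ {d} → Alg d → Instance d → List ℕ
labels A R = labelsFrom A [] R

History : ℕ → Set
History d = List (Item d × ℕ)

usedᵇ : ∀ {d} → ℕ → History d → Bool
usedᵇ b H = any (λ p → proj₂ p ℕ.≡ᵇ b) H

openᵇ : ∀ {d} → ℚ → ℕ → History d → Bool
openᵇ t b H = any (λ p → (proj₂ p ℕ.≡ᵇ b) ∧ activeᵇ t (proj₁ p)) H

loadAt : ∀ {d} → ℚ → ℕ → History d → Vec ℚ d
loadAt t b H = foldr (λ p acc → if (proj₂ p ℕ.≡ᵇ b) ∧ activeᵇ t (proj₁ p)
                                 then addV (size (proj₁ p)) acc else acc)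
                     zeroV H

fitsᵇ : ∀ {d} → ℕ → History d → Item d → Bool
fitsᵇ b H r = leq1ᵇ (addV (loadAt (arr r) b H) (size r))

-- A is a (feasible) Any Fit algorithm: on every valid instance, at every
-- arrival, (i) closed bins are never reused, (ii) capacities are respected,
-- (iii) a new bin is opened only if r fits into no currently open bin.
AnyFit : ∀ {d} → Alg d → Set
AnyFit {d} A =
  ∀ (R : Instance d) → ValidInstance R →
  ∀ (pre : Instance d) (r : Item d) (post : Instance d) → R ≡ pre ++ r ∷ post →
  let H = zip pre (labels A pre)
      b = choose A pre r
      t = arr r
  in (usedᵇ b H ≡ true → openᵇ t b H ≡ true)
   × (openᵇ t b H ≡ true → fitsᵇ b H r ≡ true)
   × (usedᵇ b H ≡ false → ∀ b′ → openᵇ t b′ H ≡ true → fitsᵇ b′ H r ≡ false)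

cost : ∀ {d} → Alg d → Instance d → ℚ
cost A R = sumℚ (map (λ b → span (map proj₁ (filter (λ p → proj₂ p ℕ.≟ b) H)))
                     (deduplicate ℕ._≟_ (labels A R)))
  where H = zip R (labels A R)

DurationRatio : ∀ {d} → Instance d → ℚ → Set
DurationRatio R μ =
  ∃ λ rmin → ∃ λ rmax → rmin ∈ R × rmax ∈ R
    × (∀ r → r ∈ R → (duration rmin ≤ duration r) × (duration r ≤ duration rmax))
    × (duration rmax ≡ μ * duration rmin)

{-# OPTIONS --safe #-}
module Submission where

-- Sizes are multiples of 1/N.  At time 0 there arrive kd pairs (large i, filler),
-- k of them for each coordinate i, all departing at time 1.  A pair sharing a bin
-- leaves one free unit in coordinate i, while each of these items needs two, so
-- an Any Fit algorithm opens one bin per pair.  At time s = 1 - 1/k there arrive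
-- kd tiny items, of one unit in every coordinate, departing at e = s + μ.  Every
-- bin has room for exactly one of them, hence all kd bins stay open during [0, e).
-- Offline, d large items with distinct i share a bin and one further bin takes all
-- fillers and tiny items, so OPT ≤ k + e.

open import Defs
open import Data.Bool using (Bool; true; false; not; if_then_else_)
import Data.Bool as Bool
open import Data.Bool.ListAction using (any)
open import Data.Bool.Properties using (T-≡)
open import Data.Empty using (⊥-elim)
open import Data.Fin as Fin using (Fin)
import Data.Fin.Properties as Fin
open import Data.Integer as ℤ using (+_)
import Data.Integer.Properties as ℤ
open import Data.List using (List; []; _∷_; [_]; _++_; map; zip; length; filter; deduplicate; applyUpTo; replicate; allFin)
open import Data.List.Membership.Propositional using (_∈_; _∉_; find)
open import Data.List.Membership.Propositional.Properties
open import Data.List.Properties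
open import Data.List.Relation.Unary.All as All using (All; []; _∷_)
import Data.List.Relation.Unary.All.Properties as All
open import Data.List.Relation.Unary.AllPairs using ([]; _∷_)
open import Data.List.Relation.Unary.Any using (here; there)
open import Data.List.Relation.Unary.Linked using (Linked; []; [-]; _∷_)
open import Data.List.Relation.Unary.Unique.Propositional using (Unique)
open import Data.List.Relation.Unary.Unique.Propositional.Properties using (Unique[x∷xs]⇒x∉xs; allFin⁺)
open import Data.Maybe using (just; nothing)
open import Data.Nat as ℕ using (ℕ; zero; suc; z≤n; s≤s) renaming (_≤_ to _≤ℕ_)
import Data.Nat.Coprimality as Coprime
import Data.Nat.Properties as ℕ
open import Data.List.Membership.DecPropositional ℕ._≟_ using (_∈?_)
open import Data.Product using (_×_; _,_; ∃; proj₁; proj₂)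
open import Data.Rational
  using (ℚ; mkℚ; 0ℚ; 1ℚ; _+_; _-_; _*_; -_; 1/_; _/_; ↥_; ↧_; _≤_; _<_; *≤*; *<*; _≤ᵇ_; Positive; positive; nonNegative)
open import Data.Rational.Properties
open import Data.Rational.Solver using (module +-*-Solver)
open import Data.Sum using (_⊎_; inj₁; inj₂)
open import Data.Vec as Vec using (Vec; tabulate; lookup)
import Data.Vec.Properties as Vec
import Data.Vec.Relation.Unary.All.Properties as VAll
open import Function using (_∘_; Equivalence; const; id)
open import Relation.Binary.PropositionalEquality hiding ([_])
open import Relation.Nullary using (¬_; ¬?; Dec; does; yes; no)

-- The factor d comes from an asymmetry: one exhausted coordinate makes a bin useless online, while
-- offline the large demands in distinct coordinates overlap almost for free. Large items alone
-- would not show this, since an Any Fit algorithm could itself pack d of them together; the filler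
-- removes the slack in the critical coordinate before the next large item arrives. Fillers must
-- nevertheless be negligible against `a`, so that all of them and all tiny items fit into one bin:
-- hence the demand 2kd² + kd ≤ a. The second wave has to come before time 1, because closed bins
-- cannot be revived; s near 1 lets every bin pay almost μ + 1. The resulting ratio is at least kde
-- / (k + e), and both losses, the 1/k in e = μ + 1 - 1/k and the summand e in the denominator,
-- become negligible as k grows. The instance is not adaptive: it depends on d, μ and δ only. The
-- freedom left to the algorithm is the choice of labels and of which bin takes which of the
-- identical tiny items, and neither affects the cost.

≤ᵇ-true : ∀ {p q} → p ≤ q → (p ≤ᵇ q) ≡ true
≤ᵇ-true p≤q = Equivalence.to T-≡ (≤⇒≤ᵇ p≤q)

≤ᵇ-false : ∀ {p q} → q < p → (p ≤ᵇ q) ≡ false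
≤ᵇ-false {p} {q} q<p with p ≤ᵇ q in eq
... | false = refl
... | true  = ⊥-elim (<-irrefl refl (<-≤-trans q<p (≤ᵇ⇒≤ (Equivalence.from T-≡ eq))))

<ᵇ-true : ∀ {p q} → p < q → (p <ᵇ q) ≡ true
<ᵇ-true p<q = cong not (≤ᵇ-false p<q)

<ᵇ-false : ∀ {p q} → q ≤ p → (p <ᵇ q) ≡ false
<ᵇ-false q≤p = cong not (≤ᵇ-true q≤p)

ℕ→ℚ-normal : ∀ n → ℕ→ℚ n ≡ mkℚ (+ n) 0 (Coprime.sym (Coprime.1-coprimeTo n))
ℕ→ℚ-normal n = normalize-coprime (Coprime.sym (Coprime.1-coprimeTo n))

ℕ→ℚ-+ : ∀ m n → ℕ→ℚ (m ℕ.+ n) ≡ ℕ→ℚ m + ℕ→ℚ n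
ℕ→ℚ-+ m n rewrite ℕ→ℚ-normal m | ℕ→ℚ-normal n =
  cong (_/ 1) (sym (cong₂ ℤ._+_ (ℤ.*-identityʳ (+ m)) (ℤ.*-identityʳ (+ n))))

ℕ→ℚ-* : ∀ m n → ℕ→ℚ (m ℕ.* n) ≡ ℕ→ℚ m * ℕ→ℚ n
ℕ→ℚ-* m n rewrite ℕ→ℚ-normal m | ℕ→ℚ-normal n = cong (_/ 1) (ℤ.pos-* m n)

ℕ→ℚ-mono-≤ : ∀ {m n} → m ℕ.≤ n → ℕ→ℚ m ≤ ℕ→ℚ n
ℕ→ℚ-mono-≤ {m} {n} m≤n rewrite ℕ→ℚ-normal m | ℕ→ℚ-normal n =
  *≤* (ℤ.*-monoʳ-≤-nonNeg (+ 1) (ℤ.+≤+ m≤n))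

ℕ→ℚ-mono-< : ∀ {m n} → m ℕ.< n → ℕ→ℚ m < ℕ→ℚ n
ℕ→ℚ-mono-< {m} {n} m<n rewrite ℕ→ℚ-normal m | ℕ→ℚ-normal n =
  *<* (ℤ.*-monoʳ-<-pos (+ 1) (ℤ.+<+ m<n))

ℕ→ℚ-pos : ∀ n → Positive (ℕ→ℚ (suc n))
ℕ→ℚ-pos n = normalize-pos (suc n) 1

-- Breakpoints of the integral and removal of duplicates

gap-just : ∀ {ps p q} → nextAbove ps p ≡ just q → gap ps p ≡ q - p
gap-just eq rewrite eq = refl

gap-nothing : ∀ {ps p} → nextAbove ps p ≡ nothing → gap ps p ≡ 0ℚ
gap-nothing eq rewrite eq = refl

-- Equality tests on the symbolic times `s` and `e` do not compute, so the outcome of each test made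
-- by `filter` is recorded by a constructor.
data Removal (x : ℚ) : List ℚ → List ℚ → Set where
  []   : Removal x [] []
  keep : ∀ {y ys zs} → x ≢ y → Removal x ys zs → Removal x (y ∷ ys) (y ∷ zs)
  drop : ∀ {ys zs} → Removal x ys zs → Removal x (x ∷ ys) zs

filter-≢ : ∀ {x ys zs} → Removal x ys zs → filter (λ y → ¬? (x ≟ y)) ys ≡ zs
filter-≢     []            = refl
filter-≢ {x} (keep x≢y rm) = trans (filter-accept (λ y → ¬? (x ≟ y)) x≢y) (cong (_ ∷_) (filter-≢ rm))
filter-≢ {x} (drop rm)     = trans (filter-reject (λ y → ¬? (x ≟ y)) (λ x≢x → x≢x refl)) (filter-≢ rm)

-- `endpoints` emits two times per item; this is the induction step for one item. `deduplicate`
-- treats the tail before filtering by the head, whence `q` is removed from `D` before `p` is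
-- removed from `E`.
dedup-cons₂ : ∀ {p q D E F} ps → deduplicate _≟_ ps ≡ D → p ≢ q → Removal q D E → Removal p E F →
              deduplicate _≟_ (p ∷ q ∷ ps) ≡ p ∷ q ∷ F
dedup-cons₂ {p} {q} ps refl p≢q rmq rmp
  rewrite filter-≢ rmq = cong (p ∷_) (filter-≢ (keep p≢q rmp))

-- Archimedean bounds and rational arithmetic

archimedean : ∀ p → ∃ λ n → p ≤ ℕ→ℚ n
archimedean p = ℤ.∣ ↥ p ∣ , p≤
  where
    i≤∣i∣ : ∀ i → i ℤ.≤ + ℤ.∣ i ∣
    i≤∣i∣ (+ n)      = ℤ.≤-refl
    i≤∣i∣ ℤ.-[1+ n ] = ℤ.-≤+

    p≤ : p ≤ ℕ→ℚ ℤ.∣ ↥ p ∣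
    p≤ rewrite ℕ→ℚ-normal ℤ.∣ ↥ p ∣ = *≤* (ℤ.≤-trans (ℤ.≤-reflexive (ℤ.*-identityʳ (↥ p)))
      (ℤ.≤-trans (i≤∣i∣ (↥ p)) (subst₂ ℤ._≤_ (ℤ.*-identityʳ _) refl
        (ℤ.*-monoˡ-≤-nonNeg (+ ℤ.∣ ↥ p ∣) {+ 1} {↧ p} (ℤ.+≤+ (s≤s z≤n))))))

p≤q⇒0≤q-p : ∀ {p q} → p ≤ q → 0ℚ ≤ q - p
p≤q⇒0≤q-p {p} {q} p≤q = subst (_≤ q - p) (+-inverseʳ p) (+-monoˡ-≤ (- p) p≤q)

p<q⇒0<q-p : ∀ {p q} → p < q → 0ℚ < q - p
p<q⇒0<q-p {p} {q} p<q = subst (_< q - p) (+-inverseʳ p) (+-monoˡ-< (- p) p<q)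

sumℚ-const : ∀ {A : Set} (f : A → ℚ) x xs → (∀ {y} → y ∈ xs → f y ≡ x) → sumℚ (map f xs) ≡ ℕ→ℚ (length xs) * x
sumℚ-const f x []       eq = sym (*-zeroˡ x)
sumℚ-const f x (y ∷ ys) eq = begin
  f y + sumℚ (map f ys)              ≡⟨ cong₂ _+_ (eq (here refl)) (sumℚ-const f x ys (eq ∘ there)) ⟩
  x + ℕ→ℚ (length ys) * x            ≡⟨ cong (_+ ℕ→ℚ (length ys) * x) (*-identityˡ x) ⟨
  1ℚ * x + ℕ→ℚ (length ys) * x       ≡⟨ *-distribʳ-+ x 1ℚ (ℕ→ℚ (length ys)) ⟨
  (1ℚ + ℕ→ℚ (length ys)) * x         ≡⟨ cong (_* x) (ℕ→ℚ-+ 1 (length ys)) ⟨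
  ℕ→ℚ (suc (length ys)) * x          ∎
  where open ≡-Reasoning

*-mono-nonNeg : ∀ {p q r} → 0ℚ ≤ p → q ≤ r → p * q ≤ p * r
*-mono-nonNeg {p} 0≤p q≤r = *-monoˡ-≤-nonNeg p {{nonNegative 0≤p}} q≤r

reciprocal : ∀ {K} → 1ℚ < K → ∃ λ τ → 0ℚ < τ × τ < 1ℚ × K * τ ≡ 1ℚ
reciprocal {K} 1<K = 1/ K , positive⁻¹ (1/ K) ,
  subst₂ _<_ (*-identityˡ (1/ K)) (*-inverseʳ K) (*-monoˡ-<-pos (1/ K) 1<K) , *-inverseʳ K
  where
    instance
      K-pos = positive (<-trans (*<* (ℤ.+<+ (s≤s z≤n))) 1<K)
      K-nonZero = pos⇒nonZero K
      1/K-pos = 1/pos⇒pos K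

archimedean-* : ∀ {δ} x → 0ℚ < δ → ∃ λ k → 1 ℕ.< k × x ≤ δ * ℕ→ℚ k
-- The summand 2 ensures `1 < k`, so that the reciprocal of k is below 1 and the second arrival time
-- s is positive.
archimedean-* {δ} x 0<δ = 2 ℕ.+ n , s≤s (s≤s z≤n) , (begin
  x                   ≡⟨ *-identityʳ x ⟨
  x * 1ℚ              ≡⟨ cong (x *_) (*-inverseˡ δ) ⟨
  x * (1/ δ * δ)      ≡⟨ *-assoc x (1/ δ) δ ⟨
  x * 1/ δ * δ        ≤⟨ *-monoʳ-≤-nonNeg δ (proj₂ (archimedean (x * 1/ δ))) ⟩
  ℕ→ℚ n * δ           ≡⟨ *-comm (ℕ→ℚ n) δ ⟩
  δ * ℕ→ℚ n           ≤⟨ *-monoˡ-≤-nonNeg δ (ℕ→ℚ-mono-≤ (ℕ.m≤n+m n 2)) ⟩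
  δ * ℕ→ℚ (2 ℕ.+ n)   ∎)
  where
    open ≤-Reasoning
    instance
      δ-pos = positive 0<δ
      δ-nonZero = pos⇒nonZero δ
      δ-nonNeg = pos⇒nonNeg δ

    n : ℕ
    n = proj₁ (archimedean (x * 1/ δ))

-- Vectors, duplicate-free lists and label sequences

leq1-true : ∀ {n} (v : Vec ℚ n) → (∀ i → lookup v i ≤ 1ℚ) → leq1ᵇ v ≡ true
leq1-true Vec.[]      v≤1 = refl
leq1-true (x Vec.∷ v) v≤1 rewrite ≤ᵇ-true (v≤1 Fin.zero) = leq1-true v (v≤1 ∘ Fin.suc)

leq1-lookup : ∀ {n} (v : Vec ℚ n) → leq1ᵇ v ≡ true → ∀ i → lookup v i ≤ 1ℚ
leq1-lookup (x Vec.∷ v) eq i with x ≤ᵇ 1ℚ in x≤1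
leq1-lookup (x Vec.∷ v) eq Fin.zero    | true = ≤ᵇ⇒≤ (Equivalence.from T-≡ x≤1)
leq1-lookup (x Vec.∷ v) eq (Fin.suc i) | true = leq1-lookup v eq i

zipWith-tabulate : ∀ {A B C : Set} (_∙_ : A → B → C) {n} (f : Fin n → A) g →
                   Vec.zipWith _∙_ (tabulate f) (tabulate g) ≡ tabulate (λ i → f i ∙ g i)
zipWith-tabulate _∙_ {zero}  f g = refl
zipWith-tabulate _∙_ {suc n} f g = cong (_ Vec.∷_) (zipWith-tabulate _∙_ (f ∘ Fin.suc) (g ∘ Fin.suc))

tabulate-const : ∀ {A : Set} (x : A) {n} → tabulate {n = n} (const x) ≡ Vec.replicate n x
tabulate-const x {zero}  = refl
tabulate-const x {suc n} = cong (x Vec.∷_) (tabulate-const x)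

≡ᵇ-refl : ∀ n → (n ℕ.≡ᵇ n) ≡ true
≡ᵇ-refl n = Equivalence.to T-≡ (ℕ.≡⇒≡ᵇ n n refl)

≢⇒≡ᵇ-false : ∀ {m n} → m ≢ n → (m ℕ.≡ᵇ n) ≡ false
≢⇒≡ᵇ-false {m} {n} m≢n with m ℕ.≡ᵇ n in eq
... | false = refl
... | true  = ⊥-elim (m≢n (ℕ.≡ᵇ⇒≡ m n (Equivalence.from T-≡ eq)))

∈-remove : ∀ {A : Set} {x y : A} ys {zs} → x ≢ y → x ∈ ys ++ y ∷ zs → x ∈ ys ++ zs
∈-remove ys x≢y x∈ with ∈-++⁻ ys x∈
... | inj₁ x∈ys         = ∈-++⁺ˡ x∈ys
... | inj₂ (here x≡y)   = ⊥-elim (x≢y x≡y)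
... | inj₂ (there x∈zs) = ∈-++⁺ʳ ys x∈zs

-- Pigeonhole: the head of `xs` is deleted from `ys`, and the tail stays included because a
-- duplicate-free list does not repeat its head.
Unique-⊆⇒length-≤ : ∀ {A : Set} {xs ys : List A} → Unique xs → (∀ {x} → x ∈ xs → x ∈ ys) → length xs ℕ.≤ length ys
Unique-⊆⇒length-≤ {xs = []}     _ _ = z≤n
Unique-⊆⇒length-≤ {xs = x ∷ xs} ux@(_ ∷ u) xs⊆ys with ∈-∃++ (xs⊆ys (here refl))
... | ys , zs , refl = ℕ.≤-trans
  (s≤s (Unique-⊆⇒length-≤ u λ {y} y∈ → ∈-remove ys (λ { refl → Unique[x∷xs]⇒x∉xs ux y∈ }) (xs⊆ys (there y∈))))
  (ℕ.≤-reflexive (sym (length-++-∷ ys)))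
  where
    length-++-∷ : ∀ ys {y zs} → length (ys ++ y ∷ zs) ≡ suc (length (ys ++ zs))
    length-++-∷ []       = refl
    length-++-∷ (_ ∷ ys) = cong suc (length-++-∷ ys)

module _ {d} (A : Alg d) where

  -- An online choice depends on earlier items only, so a further arrival leaves all previous labels
  -- unchanged. This lets a run be built item by item.
  zip-labelsFrom-snoc : ∀ past xs r → zip (xs ++ [ r ]) (labelsFrom A past (xs ++ [ r ])) ≡
                                      zip xs (labelsFrom A past xs) ++ [ (r , choose A (past ++ xs) r) ]
  zip-labelsFrom-snoc past []       r rewrite ++-identityʳ past = refl
  zip-labelsFrom-snoc past (x ∷ xs) r rewrite sym (++-assoc past [ x ] xs) =
    cong (_ ∷_) (zip-labelsFrom-snoc (past ++ [ x ]) xs r)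

  zip-labelsFrom-proj₂ : ∀ past xs → map proj₂ (zip xs (labelsFrom A past xs)) ≡ labelsFrom A past xs
  zip-labelsFrom-proj₂ past []       = refl
  zip-labelsFrom-proj₂ past (x ∷ xs) = cong (_ ∷_) (zip-labelsFrom-proj₂ _ xs)

-- Upper bounds from the exhaustive bin search

any-true : ∀ {A : Set} (p : A → Bool) {x xs} → x ∈ xs → p x ≡ true → any p xs ≡ true
any-true p {xs = x ∷ xs} (here refl) px rewrite px = refl
any-true p {xs = x ∷ xs} (there x∈)  px with p x
... | true  = refl
... | false = any-true p x∈ px

applyUpTo-cong : ∀ {A : Set} {f g : ℕ → A} → f ≗ g → ∀ n → applyUpTo f n ≡ applyUpTo g n
applyUpTo-cong f≗g zero    = refl
applyUpTo-cong f≗g (suc n) = cong₂ _∷_ (f≗g 0) (applyUpTo-cong (f≗g ∘ suc) n)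

applyUpTo-const : ∀ {A : Set} (x : A) n → applyUpTo (const x) n ≡ replicate n x
applyUpTo-const x zero    = refl
applyUpTo-const x (suc n) = cong (x ∷_) (applyUpTo-const x n)

-- Loads are given as functions of the bin index, so that the branch of `inserts` which uses bin `b`
-- is described pointwise: `g` differs from `f` at `b` alone.
inserts-applyUpTo : ∀ {d} {f g : ℕ → Vec ℚ d} {v b K} → b ℕ.< K → leq1ᵇ (addV (f b) v) ≡ true →
                    g b ≡ addV (f b) v → (∀ {c} → b ≢ c → g c ≡ f c) →
                    applyUpTo g K ∈ inserts v (applyUpTo f K)
inserts-applyUpTo {f = f} {g} {v} {zero} {suc K} b<K ok gb g≗f rewrite ok =
  here (cong₂ _∷_ gb (applyUpTo-cong (λ c → g≗f λ ()) K))
inserts-applyUpTo {f = f} {g} {v} {suc b} {suc K} (s≤s b<K) ok gb g≗f =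
  ∈-++⁺ʳ (if leq1ᵇ (addV (f 0) v) then _ else _)
    (subst (λ w → w ∷ applyUpTo (g ∘ suc) K ∈ map (f 0 ∷_) (inserts v (applyUpTo (f ∘ suc) K))) (sym (g≗f λ ()))
      (∈-map⁺ (f 0 ∷_) (inserts-applyUpTo b<K ok gb (λ b≢c → g≗f (b≢c ∘ ℕ.suc-injective)))))

-- The candidate `k` grows by one and cannot step past `K`, where the packing test succeeds. Running
-- out of fuel returns the current candidate, which is still at most `K`.
searchBins-≤ : ∀ {d} (L : List (Vec ℚ d)) {K} → packᵇ L (replicate K zeroV) ≡ true →
               ∀ {k} n → k ℕ.≤ K → searchBins L k n ℕ.≤ K
searchBins-≤ L     packed     zero    k≤K = k≤K
searchBins-≤ L {K} packed {k} (suc n) k≤K with packᵇ L (replicate k zeroV) in eq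
... | true  = k≤K
... | false = searchBins-≤ L packed n (ℕ.≤∧≢⇒< k≤K λ { refl → false≢true (trans (sym eq) packed) })
  where
    false≢true : false ≢ true
    false≢true ()

-- The arithmetic of the competitive ratio

-- With M = μ + 1 and e = M - τ, the inequality reduces to D (M² + 1) ≤ δ K, since K τ = 1.
ratio-bound : ∀ {M D K δ τ} → 0ℚ ≤ M → 0ℚ ≤ δ → 0ℚ ≤ τ → 0ℚ ≤ M * D - δ → K * τ ≡ 1ℚ →
              D * (M * M + 1ℚ) ≤ δ * K → (M * D - δ) * (K + (M - τ)) ≤ K * D * (M - τ)
ratio-bound {M} {D} {K} {δ} {τ} 0≤M 0≤δ 0≤τ 0≤c Kτ≡1 enough = begin
  (M * D - δ) * (K + (M - τ))
    ≡⟨ solve 5 (λ M D K δ τ → (M :* D :- δ) :* (K :+ (M :- τ)) :=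
                  K :* D :* M :- D :+ (D :* (M :* M :+ con 1ℚ) :- δ :* K) :- (M :* D :- δ) :* τ :- δ :* M)
         refl M D K δ τ ⟩
  K * D * M - D + (D * (M * M + 1ℚ) - δ * K) - (M * D - δ) * τ - δ * M
    ≤⟨ subtract (*-nonNeg 0≤δ 0≤M) ⟩
  K * D * M - D + (D * (M * M + 1ℚ) - δ * K) - (M * D - δ) * τ
    ≤⟨ subtract (*-nonNeg 0≤c 0≤τ) ⟩
  K * D * M - D + (D * (M * M + 1ℚ) - δ * K)
    ≤⟨ +-monoʳ-≤ (K * D * M - D) (+-monoˡ-≤ (- (δ * K)) enough) ⟩
  K * D * M - D + (δ * K - δ * K)
    ≡⟨ solve 4 (λ M D K x → K :* D :* M :- D :+ (x :- x) := K :* D :* M :- D :* con 1ℚ) refl M D K (δ * K) ⟩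
  K * D * M - D * 1ℚ
    ≡⟨ cong (λ x → K * D * M - D * x) Kτ≡1 ⟨
  K * D * M - D * (K * τ)
    ≡⟨ solve 4 (λ M D K τ → K :* D :* M :- D :* (K :* τ) := K :* D :* (M :- τ)) refl M D K τ ⟩
  K * D * (M - τ) ∎
  where
    open ≤-Reasoning
    open +-*-Solver

    *-nonNeg : ∀ {p q} → 0ℚ ≤ p → 0ℚ ≤ q → 0ℚ ≤ p * q
    *-nonNeg {p} {q} 0≤p 0≤q = subst (_≤ p * q) (*-zeroʳ p) (*-mono-nonNeg {p} 0≤p 0≤q)

    subtract : ∀ {p q} → 0ℚ ≤ q → p - q ≤ p
    subtract {p} {q} 0≤q = subst (p - q ≤_) (+-identityʳ p) (+-monoʳ-≤ p (neg-antimono-≤ 0≤q))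

-- The upper bound on `O` may be multiplied only by a nonnegative factor. If δ exceeds `M * D`, the
-- left side is at most 0 and the nonnegative cost bound suffices.
competitive : ∀ {M D K δ τ O C} → 0ℚ ≤ M → 0ℚ ≤ δ → 0ℚ ≤ τ → 0ℚ ≤ K * D * (M - τ) → K * τ ≡ 1ℚ →
              D * (M * M + 1ℚ) ≤ δ * K → 0ℚ ≤ O → O ≤ K + (M - τ) → K * D * (M - τ) ≤ C →
              (M * D - δ) * O ≤ C
competitive {M} {D} {K} {δ} {τ} {O} {C} 0≤M 0≤δ 0≤τ 0≤KD Kτ≡1 enough 0≤O O≤ ≤C with ≤-total 0ℚ (M * D - δ)
... | inj₁ 0≤c = begin
  (M * D - δ) * O               ≤⟨ *-mono-nonNeg {M * D - δ} 0≤c O≤ ⟩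
  (M * D - δ) * (K + (M - τ))   ≤⟨ ratio-bound {M} {D} {K} {δ} {τ} 0≤M 0≤δ 0≤τ 0≤c Kτ≡1 enough ⟩
  K * D * (M - τ)               ≤⟨ ≤C ⟩
  C                             ∎
  where open ≤-Reasoning
... | inj₂ c≤0 = begin
  (M * D - δ) * O   ≤⟨ *-monoʳ-≤-nonNeg O {{nonNegative 0≤O}} c≤0 ⟩
  0ℚ * O            ≡⟨ *-zeroˡ O ⟩
  0ℚ                ≤⟨ 0≤KD ⟩
  K * D * (M - τ)   ≤⟨ ≤C ⟩
  C                 ∎
  where open ≤-Reasoning

-- The hard instance: times and integrals

Interval : ∀ {d} → ℚ → ℚ → Item d → Set
Interval p q r = arr r ≡ p × dep r ≡ q

data Kind (d : ℕ) : Set where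
  large       : Fin d → Kind d
  filler tiny : Kind d

module Gadget (d a : ℕ) (2≤a : 2 ℕ.≤ a) (s e : ℚ) (0<s : 0ℚ < s) (s<1 : s < 1ℚ) (1<e : 1ℚ < e) where

  private
    >⇒≢ : ∀ {p q} → p < q → q ≢ p
    >⇒≢ p<q q≡p = <⇒≢ p<q (sym q≡p)

    s<e : s < e
    s<e = <-trans s<1 1<e

    0<e : 0ℚ < e
    0<e = <-trans 0<s s<e

    -- The order is that of first occurrence among the endpoints, early items preceding late ones,
    -- and not the numerical order.
    breakpoints : List ℚ
    breakpoints = 0ℚ ∷ 1ℚ ∷ s ∷ e ∷ []

  nextAbove-0 : nextAbove breakpoints 0ℚ ≡ just s
  nextAbove-0 rewrite <ᵇ-true 0<e | <ᵇ-true 0<s | <ᵇ-true s<e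
                    | <ᵇ-false (<⇒≤ s<1) = refl

  nextAbove-s : nextAbove breakpoints s ≡ just 1ℚ
  nextAbove-s rewrite <ᵇ-true s<e | <ᵇ-false (≤-refl {s}) | <ᵇ-true s<1 | <ᵇ-true 1<e
                    | <ᵇ-false (<⇒≤ 0<s) = refl

  nextAbove-1 : nextAbove breakpoints 1ℚ ≡ just e
  nextAbove-1 rewrite <ᵇ-true 1<e | <ᵇ-false (<⇒≤ s<1) = refl

  nextAbove-e : nextAbove breakpoints e ≡ nothing
  nextAbove-e rewrite <ᵇ-false (≤-refl {e}) | <ᵇ-false (<⇒≤ s<e) | <ᵇ-false (<⇒≤ 1<e)
                    | <ᵇ-false (<⇒≤ 0<e) = refl

  integrate-steps : ∀ ps f → deduplicate _≟_ ps ≡ breakpoints →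
                    integrate ps f ≡ s * f 0ℚ + (1ℚ - s) * f s + (e - 1ℚ) * f 1ℚ
  integrate-steps ps f eq
    rewrite eq
          | gap-just {breakpoints} nextAbove-0 | gap-just {breakpoints} nextAbove-s
          | gap-just {breakpoints} nextAbove-1 | gap-nothing {breakpoints} nextAbove-e =
    -- The summands follow the order 0, 1, s, e, and the last has gap 0. The gap `s - 0ℚ` appears as
    -- `s :+ con 0ℚ` because `- 0ℚ` computes to `0ℚ`.
    solve 6 (λ x y z w s e → (s :+ con 0ℚ) :* x :+ ((e :- con 1ℚ) :* z :+ ((con 1ℚ :- s) :* y :+ (con 0ℚ :* w :+ con 0ℚ)))
                := s :* x :+ (con 1ℚ :- s) :* y :+ (e :- con 1ℚ) :* z)
      refl (f 0ℚ) (f s) (f 1ℚ) (f e) s e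
    where open +-*-Solver

  dedup-late : ∀ r (ys : Instance d) → Interval s e r → All (Interval s e) ys →
               deduplicate _≟_ (endpoints (r ∷ ys)) ≡ s ∷ e ∷ []
  dedup-late r []       (refl , refl) []       = dedup-cons₂ [] refl (<⇒≢ s<e) [] []
  dedup-late r (y ∷ ys) (refl , refl) (p ∷ ps) =
    dedup-cons₂ (endpoints (y ∷ ys)) (dedup-late y ys p ps) (<⇒≢ s<e)
      (keep (>⇒≢ s<e) (drop [])) (drop [])

  dedup-early-late : ∀ r (xs : Instance d) r′ ys →
                     Interval 0ℚ 1ℚ r → All (Interval 0ℚ 1ℚ) xs → Interval s e r′ → All (Interval s e) ys →
                     deduplicate _≟_ (endpoints (r ∷ xs ++ r′ ∷ ys)) ≡ breakpoints
  dedup-early-late r [] r′ ys (refl , refl) [] q qs =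
    dedup-cons₂ (endpoints (r′ ∷ ys)) (dedup-late r′ ys q qs) (λ ())
      (keep (>⇒≢ s<1) (keep (<⇒≢ 1<e) [])) (keep (<⇒≢ 0<s) (keep (<⇒≢ 0<e) []))
  dedup-early-late r (x ∷ xs) r′ ys (refl , refl) (p ∷ ps) q qs =
    dedup-cons₂ (endpoints (x ∷ xs ++ r′ ∷ ys)) (dedup-early-late x xs r′ ys p ps q qs) (λ ())
      (keep (λ ()) (drop (keep (>⇒≢ s<1) (keep (<⇒≢ 1<e) []))))
      (drop (keep (<⇒≢ 0<s) (keep (<⇒≢ 0<e) [])))

  -- Sizes as integer multiples of a unit

  -- A large item and a filler occupy N - 1 units of the large coordinate.
  N : ℕ
  N = suc (a ℕ.+ 2 ℕ.* d)

  -- The off-diagonal 2 makes a large item too big for one free unit in whichever coordinate it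
  -- meets it. The price offline is at most 2d per coordinate for a bin of d large items, which is
  -- what `N` allows beyond `a` and the last unit.
  units : Kind d → Fin d → ℕ
  units (large i) j = if does (i Fin.≟ j) then a else 2
  units filler    _ = 2 ℕ.* d
  units tiny      _ = 1

  private instance
    N-pos : Positive (ℕ→ℚ N)
    N-pos = ℕ→ℚ-pos (a ℕ.+ 2 ℕ.* d)

    N-nonZero = pos⇒nonZero (ℕ→ℚ N)
    unit-pos = 1/pos⇒pos (ℕ→ℚ N)
    unit-nonNeg = pos⇒nonNeg (1/ ℕ→ℚ N)

  opaque
    -- Kept abstract so that sizes are handled only through the laws below, which reduce every
    -- capacity question to an inequality in ℕ.
    scale : ℕ → ℚ
    scale n = ℕ→ℚ n * 1/ ℕ→ℚ N

    scale-+ : ∀ m n → scale (m ℕ.+ n) ≡ scale m + scale n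
    scale-+ m n = trans (cong (_* 1/ ℕ→ℚ N) (ℕ→ℚ-+ m n)) (*-distribʳ-+ (1/ ℕ→ℚ N) (ℕ→ℚ m) (ℕ→ℚ n))

    scale-0 : scale 0 ≡ 0ℚ
    scale-0 = *-zeroˡ (1/ ℕ→ℚ N)

    scale-N : scale N ≡ 1ℚ
    scale-N = *-inverseʳ (ℕ→ℚ N)

    scale-mono-≤ : ∀ {m n} → m ℕ.≤ n → scale m ≤ scale n
    scale-mono-≤ {m} {n} m≤n = *-monoʳ-≤-nonNeg (1/ ℕ→ℚ N) (ℕ→ℚ-mono-≤ m≤n)

    scale-mono-< : ∀ {m n} → m ℕ.< n → scale m < scale n
    scale-mono-< {m} {n} m<n = *-monoˡ-<-pos (1/ ℕ→ℚ N) (ℕ→ℚ-mono-< m<n)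

  scale-≤1 : ∀ {n} → n ℕ.≤ N → scale n ≤ 1ℚ
  scale-≤1 n≤N = subst (scale _ ≤_) scale-N (scale-mono-≤ n≤N)

  scale-≤1⁻ : ∀ {n} → scale n ≤ 1ℚ → n ℕ.≤ N
  scale-≤1⁻ {n} ≤1 = ℕ.≮⇒≥ λ N<n → <-irrefl refl (<-≤-trans (subst (_< scale n) scale-N (scale-mono-< N<n)) ≤1)

  0≤scale : ∀ n → 0ℚ ≤ scale n
  0≤scale n = subst (_≤ scale n) scale-0 (scale-mono-≤ z≤n)

  scaled : (Fin d → ℕ) → Vec ℚ d
  scaled f = tabulate (scale ∘ f)

  addV-scaled : ∀ f g → addV (scaled f) (scaled g) ≡ scaled (λ j → f j ℕ.+ g j)
  addV-scaled f g = trans (zipWith-tabulate _+_ (scale ∘ f) (scale ∘ g))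
                          (Vec.tabulate-cong (λ j → sym (scale-+ (f j) (g j))))

  zeroV-scaled : zeroV ≡ scaled (const 0)
  zeroV-scaled = sym (trans (Vec.tabulate-cong (λ _ → scale-0)) (tabulate-const 0ℚ))

  leq1-scaled : ∀ {f} → (∀ j → f j ℕ.≤ N) → leq1ᵇ (scaled f) ≡ true
  leq1-scaled f≤N = leq1-true (scaled _) λ j → subst (_≤ 1ℚ) (sym (Vec.lookup∘tabulate _ j)) (scale-≤1 (f≤N j))

  leq1-scaled⁻ : ∀ f → leq1ᵇ (scaled f) ≡ true → ∀ j → f j ℕ.≤ N
  leq1-scaled⁻ f eq j = scale-≤1⁻ (subst (_≤ 1ℚ) (Vec.lookup∘tabulate _ j) (leq1-lookup (scaled f) eq j))

  start finish : Kind d → ℚ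
  start (large _) = 0ℚ
  start filler    = 0ℚ
  start tiny      = s
  finish (large _) = 1ℚ
  finish filler    = 1ℚ
  finish tiny      = e

  toItem : Kind d → Item d
  toItem κ = item (start κ) (finish κ) (scaled (units κ))

  -- Labelled packings and their loads

  Packing : Set
  Packing = List (Kind d × ℕ)

  history : Packing → History d
  history = map (λ (κ , b) → toItem κ , b)

  items : Packing → Instance d
  items = map (toItem ∘ proj₁)

  bins : Packing → List ℕ
  bins = map proj₂

  load : ℕ → Packing → Fin d → ℕ
  load b []            j = 0
  load b ((κ , c) ∷ H) j = (if c ℕ.≡ᵇ b then units κ j else 0) ℕ.+ load b H j

  load-hit : ∀ b κ H j → load b ((κ , b) ∷ H) j ≡ units κ j ℕ.+ load b H j
  load-hit b κ H j rewrite ≡ᵇ-refl b = refl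

  load-miss : ∀ {b c} κ H j → c ≢ b → load b ((κ , c) ∷ H) j ≡ load b H j
  load-miss κ H j c≢b rewrite ≢⇒≡ᵇ-false c≢b = refl

  load-++ : ∀ b G H j → load b (G ++ H) j ≡ load b G j ℕ.+ load b H j
  load-++ b []            H j = refl
  load-++ b ((κ , c) ∷ G) H j rewrite load-++ b G H j =
    sym (ℕ.+-assoc (if c ℕ.≡ᵇ b then units κ j else 0) (load b G j) (load b H j))

  load-none : ∀ {b} H j → All (λ p → proj₂ p ≢ b) H → load b H j ≡ 0
  load-none []            j []         = refl
  load-none ((κ , c) ∷ H) j (c≢b ∷ ≢b) = trans (load-miss κ H j c≢b) (load-none H j ≢b)

  load-absent : ∀ {b} H j → b ∉ bins H → load b H j ≡ 0
  load-absent H j b∉ = load-none H j (All.tabulate λ { p∈ refl → b∉ (∈-map⁺ proj₂ p∈) })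

  Active : ℚ → Kind d × ℕ → Set
  Active t p = activeᵇ t (toItem (proj₁ p)) ≡ true

  -- While every recorded item is active, the load at time `t` no longer depends on `t`; this
  -- connects the rational load vectors with the counts in ℕ.
  loadAt-history : ∀ t b H → All (Active t) H → loadAt t b (history H) ≡ scaled (load b H)
  loadAt-history t b []            []         = zeroV-scaled
  loadAt-history t b ((κ , c) ∷ H) (act ∷ as) rewrite act with c ℕ.≡ᵇ b
  ... | false = loadAt-history t b H as
  ... | true  = trans (cong (addV (scaled (units κ))) (loadAt-history t b H as)) (addV-scaled (units κ) (load b H))

  ∈⇒open : ∀ t {b} H → All (Active t) H → b ∈ bins H → openᵇ t b (history H) ≡ true
  ∈⇒open t {b} ((κ , _) ∷ H) (act ∷ _)  (here refl) rewrite act | ≡ᵇ-refl b = refl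
  ∈⇒open t {b} ((κ , c) ∷ H) (act ∷ as) (there b∈) rewrite act with c ℕ.≡ᵇ b
  ... | true  = refl
  ... | false = ∈⇒open t H as b∈

  ∉⇒unused : ∀ {b} H → b ∉ bins H → usedᵇ b (history H) ≡ false
  ∉⇒unused     []            b∉ = refl
  ∉⇒unused {b} ((κ , c) ∷ H) b∉ rewrite ≢⇒≡ᵇ-false {c} {b} (λ { refl → b∉ (here refl) }) = ∉⇒unused H (b∉ ∘ there)

  Fits : ℕ → Packing → Kind d → Set
  Fits b H κ = ∀ j → load b H j ℕ.+ units κ j ℕ.≤ N

  fitsᵇ-history : ∀ b H κ → All (Active (start κ)) H →
                  fitsᵇ b (history H) (toItem κ) ≡ leq1ᵇ (scaled (λ j → load b H j ℕ.+ units κ j))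
  fitsᵇ-history b H κ as = cong leq1ᵇ
    (trans (cong (λ v → addV v (scaled (units κ))) (loadAt-history (start κ) b H as)) (addV-scaled (load b H) (units κ)))

  2d≤a+2d : 2 ℕ.* d ℕ.≤ a ℕ.+ 2 ℕ.* d
  2d≤a+2d = ℕ.m≤n+m (2 ℕ.* d) a

  units-large-≤ : ∀ i j → units (large i) j ℕ.≤ a
  units-large-≤ i j with does (i Fin.≟ j)
  ... | true  = ℕ.≤-refl
  ... | false = 2≤a

  units-≤N : ∀ κ j → units κ j ℕ.≤ N
  units-≤N (large i) j = ℕ.m≤n⇒m≤1+n (ℕ.≤-trans (units-large-≤ i j) (ℕ.m≤m+n a (2 ℕ.* d)))
  units-≤N filler    j = ℕ.m≤n⇒m≤1+n 2d≤a+2d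
  units-≤N tiny      j = s≤s z≤n

  2≤units-large : ∀ i j → 2 ℕ.≤ units (large i) j
  2≤units-large i j with does (i Fin.≟ j)
  ... | true  = 2≤a
  ... | false = ℕ.≤-refl

  units-large-diag : ∀ i → units (large i) i ≡ a
  units-large-diag i with i Fin.≟ i
  ... | yes _  = refl
  ... | no i≢i = ⊥-elim (i≢i refl)

  2≤2d : Fin d → 2 ℕ.≤ 2 ℕ.* d
  2≤2d i = ℕ.*-monoʳ-≤ 2 {1} {d} (ℕ.≤-trans (s≤s z≤n) (Fin.toℕ<n i))

  toItem-valid : ∀ κ → ValidItem (toItem κ)
  toItem-valid κ = 0≤start κ , start<finish κ , VAll.tabulate⁺ (λ j → 0≤scale _ , scale-≤1 (units-≤N κ j))
    where
      0≤start : ∀ κ → 0ℚ ≤ start κ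
      0≤start (large _) = ≤-refl
      0≤start filler    = ≤-refl
      0≤start tiny      = <⇒≤ 0<s

      start<finish : ∀ κ → start κ < finish κ
      start<finish (large _) = <-trans 0<s s<1
      start<finish filler    = <-trans 0<s s<1
      start<finish tiny      = <-trans s<1 1<e

  -- The two waves of arrivals

  Early Late : Kind d × ℕ → Set
  Early p = start (proj₁ p) ≡ 0ℚ
  Late  p = start (proj₁ p) ≡ s

  items-valid : ∀ G H → All Early G → All Late H → ValidInstance (items (G ++ H))
  items-valid G H early late = All.map⁺ (All.universal (toItem-valid ∘ proj₁) (G ++ H)) , linked G early
    where
      late-linked : ∀ H → All Late H → Linked (λ r r′ → arr r ≤ arr r′) (items H)
      late-linked []          []           = []
      late-linked (x ∷ [])    (_ ∷ [])     = [-]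
      late-linked (x ∷ y ∷ H) (p ∷ q ∷ qs) = ≤-reflexive (trans p (sym q)) ∷ late-linked (y ∷ H) (q ∷ qs)

      linked : ∀ G → All Early G → Linked (λ r r′ → arr r ≤ arr r′) (items (G ++ H))
      linked []          []           = late-linked H late
      linked (x ∷ y ∷ G) (p ∷ q ∷ ps) = ≤-reflexive (trans p (sym q)) ∷ linked (y ∷ G) (q ∷ ps)
      linked (x ∷ [])    (p ∷ [])     = link H late (late-linked H late)
        where
          link : ∀ H → All Late H → Linked (λ r r′ → arr r ≤ arr r′) (items H) →
                 Linked (λ r r′ → arr r ≤ arr r′) (items (x ∷ H))
          link []      _       _  = [-]
          link (y ∷ H) (q ∷ _) ls = subst₂ _≤_ (sym p) (sym q) (<⇒≤ 0<s) ∷ ls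

  early-active-0 : ∀ p → Early p → Active 0ℚ p
  early-active-0 (large _ , _) _   = refl
  early-active-0 (filler , _)  _   = refl
  early-active-0 (tiny , _)    s≡0 = ⊥-elim (<⇒≢ 0<s (sym s≡0))

  early-active-s : ∀ p → Early p → Active s p
  early-active-s (large _ , _) _ rewrite ≤ᵇ-true (<⇒≤ 0<s) | <ᵇ-true s<1 = refl
  early-active-s (filler , _)  _ rewrite ≤ᵇ-true (<⇒≤ 0<s) | <ᵇ-true s<1 = refl
  early-active-s (tiny , _)    s≡0 = ⊥-elim (<⇒≢ 0<s (sym s≡0))

  late-active : ∀ {t} → s ≤ t → t < e → ∀ p → Late p → Active t p
  late-active s≤t t<e (large _ , _) 0≡s = ⊥-elim (<⇒≢ 0<s 0≡s)
  late-active s≤t t<e (filler , _)  0≡s = ⊥-elim (<⇒≢ 0<s 0≡s)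
  late-active s≤t t<e (tiny , _)    _ rewrite ≤ᵇ-true s≤t | <ᵇ-true t<e = refl

  -- g = id describes the online packing, g = const 0 the offline one, in which
  -- all fillers share bin 0.  In blocks and tinys the head of the list arrives last.
  pair : (ℕ → ℕ) → Fin d → ℕ → Packing
  pair g i b = (large i , b) ∷ (filler , g b) ∷ []

  blocks : (ℕ → ℕ) → List (Fin d × ℕ) → Packing
  blocks g []             = []
  blocks g ((i , b) ∷ ps) = blocks g ps ++ pair g i b

  tinys : List ℕ → Packing
  tinys []       = []
  tinys (c ∷ cs) = tinys cs ++ [ (tiny , c) ]

  blocks-early : ∀ g ps → All Early (blocks g ps)
  blocks-early g []       = []
  blocks-early g (_ ∷ ps) = All.++⁺ (blocks-early g ps) (refl ∷ refl ∷ [])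

  tinys-late : ∀ cs → All Late (tinys cs)
  tinys-late []       = []
  tinys-late (_ ∷ cs) = All.++⁺ (tinys-late cs) (refl ∷ [])

  bins-++⁻ : ∀ {b} G H → b ∈ bins (G ++ H) → b ∈ bins G ⊎ b ∈ bins H
  bins-++⁻ G H b∈ = ∈-++⁻ (bins G) (subst (_ ∈_) (map-++ proj₂ G H) b∈)

  bins-++⁺ˡ : ∀ {b} G H → b ∈ bins G → b ∈ bins (G ++ H)
  bins-++⁺ˡ G H b∈ = subst (_ ∈_) (sym (map-++ proj₂ G H)) (∈-++⁺ˡ b∈)

  bins-++⁺ʳ : ∀ {b} G H → b ∈ bins H → b ∈ bins (G ++ H)
  bins-++⁺ʳ G H b∈ = subst (_ ∈_) (sym (map-++ proj₂ G H)) (∈-++⁺ʳ (bins G) b∈)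

  bins-blocks⁻ : ∀ {b} ps → b ∈ bins (blocks id ps) → b ∈ map proj₂ ps
  bins-blocks⁻ ((i , c) ∷ ps) b∈ with bins-++⁻ (blocks id ps) (pair id i c) b∈
  ... | inj₁ b∈ps                = there (bins-blocks⁻ ps b∈ps)
  ... | inj₂ (here refl)         = here refl
  ... | inj₂ (there (here refl)) = here refl

  bins-blocks⁺ : ∀ {b} ps → b ∈ map proj₂ ps → b ∈ bins (blocks id ps)
  bins-blocks⁺ ((i , c) ∷ ps) (here refl) = bins-++⁺ʳ (blocks id ps) (pair id i c) (here refl)
  bins-blocks⁺ ((i , c) ∷ ps) (there b∈)  = bins-++⁺ˡ (blocks id ps) (pair id i c) (bins-blocks⁺ ps b∈)

  bins-tinys⁻ : ∀ {b} cs → b ∈ bins (tinys cs) → b ∈ cs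
  bins-tinys⁻ (c ∷ cs) b∈ with bins-++⁻ (tinys cs) [ (tiny , c) ] b∈
  ... | inj₁ b∈cs        = there (bins-tinys⁻ cs b∈cs)
  ... | inj₂ (here refl) = here refl

  load-pair : ∀ i b j → load b (pair id i b) j ≡ units (large i) j ℕ.+ 2 ℕ.* d
  load-pair i b j = trans (load-hit b (large i) [ (filler , b) ] j) (cong (units (large i) j ℕ.+_)
    (trans (load-hit b filler [] j) (ℕ.+-identityʳ (2 ℕ.* d))))

  -- The exhausted coordinate varies with the bin: it is the one of its own large item.
  blocks-full : ∀ {b} ps → b ∈ map proj₂ ps → ∃ λ i → a ℕ.+ 2 ℕ.* d ℕ.≤ load b (blocks id ps) i
  blocks-full {b} ((i , b) ∷ ps) (here refl) = i , (begin
    a ℕ.+ 2 ℕ.* d                   ≡⟨ cong (ℕ._+ 2 ℕ.* d) (units-large-diag i) ⟨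
    units (large i) i ℕ.+ 2 ℕ.* d   ≡⟨ load-pair i b i ⟨
    load b (pair id i b) i           ≤⟨ ℕ.m≤n+m _ (load b (blocks id ps) i) ⟩
    load b (blocks id ps) i ℕ.+ load b (pair id i b) i ≡⟨ load-++ b (blocks id ps) (pair id i b) i ⟨
    load b (blocks id ((i , b) ∷ ps)) i ∎)
    where open ℕ.≤-Reasoning
  blocks-full {b} ((i , c) ∷ ps) (there b∈) with blocks-full ps b∈
  ... | j , le = j , ℕ.≤-trans le (ℕ.≤-trans (ℕ.m≤m+n _ _) (ℕ.≤-reflexive (sym (load-++ b (blocks id ps) (pair id i c) j))))

  -- Distinct labels give each bin at most one pair, and `a` is the most that a large item takes in
  -- any coordinate. The unit left over is the room for one tiny item.
  blocks-notOver : ∀ {b} ps → Unique (map proj₂ ps) → ∀ j → load b (blocks id ps) j ℕ.≤ a ℕ.+ 2 ℕ.* d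
  blocks-notOver     []             u j = z≤n
  blocks-notOver {b} ((i , c) ∷ ps) uu@(_ ∷ u) j rewrite load-++ b (blocks id ps) (pair id i c) j with c ℕ.≟ b
  ... | yes refl rewrite load-absent (blocks id ps) j (Unique[x∷xs]⇒x∉xs uu ∘ bins-blocks⁻ ps) | load-pair i c j =
    ℕ.+-monoˡ-≤ (2 ℕ.* d) (units-large-≤ i j)
  ... | no c≢b rewrite load-absent {b} (pair id i c) j
                         (λ { (here refl) → c≢b refl ; (there (here refl)) → c≢b refl })
                     | ℕ.+-identityʳ (load b (blocks id ps) j) = blocks-notOver ps u j

  -- The offline packing

  -- The labels of `H` select the successful branch of the search. The initial loads `ℓ` are
  -- arbitrary for the induction, and the hypothesis bounds the final loads, which dominate all
  -- intermediate ones.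
  packᵇ-true : ∀ {K} H (ℓ : ℕ → Fin d → ℕ) → All (λ p → proj₂ p ℕ.< K) H →
               (∀ {b} → b ℕ.< K → ∀ j → ℓ b j ℕ.+ load b H j ℕ.≤ N) →
               packᵇ (map (scaled ∘ units ∘ proj₁) H) (applyUpTo (scaled ∘ ℓ) K) ≡ true
  packᵇ-true []            ℓ _          _  = refl
  packᵇ-true {K} ((κ , b) ∷ H) ℓ (b<K ∷ <K) ≤N =
    any-true (packᵇ (map (scaled ∘ units ∘ proj₁) H))
      (inserts-applyUpTo b<K ok ℓ′-b (λ b≢c → Vec.tabulate-cong λ j → cong scale (ℓ′-other b≢c j)))
      (packᵇ-true H ℓ′ <K λ {c} c<K j → subst (ℕ._≤ N) (sym (ℕ.+-assoc (ℓ c j) _ (load c H j))) (≤N c<K j))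
    where
      ℓ′ : ℕ → Fin d → ℕ
      ℓ′ c j = ℓ c j ℕ.+ (if b ℕ.≡ᵇ c then units κ j else 0)

      ℓ′-b : scaled (ℓ′ b) ≡ addV (scaled (ℓ b)) (scaled (units κ))
      ℓ′-b rewrite ≡ᵇ-refl b = sym (addV-scaled (ℓ b) (units κ))

      ℓ′-other : ∀ {c} → b ≢ c → ∀ j → ℓ′ c j ≡ ℓ c j
      ℓ′-other {c} b≢c j rewrite ≢⇒≡ᵇ-false b≢c = ℕ.+-identityʳ (ℓ c j)

      ok : leq1ᵇ (addV (scaled (ℓ b)) (scaled (units κ))) ≡ true
      ok = trans (cong leq1ᵇ (addV-scaled (ℓ b) (units κ)))
        (leq1-scaled λ j → ℕ.≤-trans (ℕ.+-monoʳ-≤ (ℓ b j)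
           (ℕ.≤-trans (ℕ.m≤m+n (units κ j) (load b H j)) (ℕ.≤-reflexive (sym (load-hit b κ H j))))) (≤N b<K j))

  active? : ∀ t p → Dec (Active t p)
  active? t p = activeᵇ t (toItem (proj₁ p)) Bool.≟ true

  filter-items : ∀ t H → map size (filter (λ r → activeᵇ t r Bool.≟ true) (items H)) ≡
                         map (scaled ∘ units ∘ proj₁) (filter (active? t) H)
  filter-items t []      = refl
  filter-items t (p ∷ H) with does (active? t p)
  ... | true  = cong (_ ∷_) (filter-items t H)
  ... | false = filter-items t H

  OPTat-≤ : ∀ {K} t H → All (λ p → proj₂ p ℕ.< K) (filter (active? t) H) →
            (∀ {b} → b ℕ.< K → ∀ j → load b (filter (active? t) H) j ℕ.≤ N) → OPTat (items H) t ℕ.≤ K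
  OPTat-≤ {K} t H <K ≤N rewrite filter-items t H = searchBins-≤ _
    (subst (λ loads → packᵇ (map (scaled ∘ units ∘ proj₁) (filter (active? t) H)) loads ≡ true)
      (trans (applyUpTo-const (scaled (const 0)) K) (cong (replicate K) (sym zeroV-scaled)))
      (packᵇ-true (filter (active? t) H) (λ _ _ → 0) <K ≤N))
    (length (map (scaled ∘ units ∘ proj₁) (filter (active? t) H))) z≤n

  -- Lets a single capacity check, with all items counted at once, serve at every moment.
  load-filter-≤ : ∀ {P : Kind d × ℕ → Set} (P? : ∀ p → Dec (P p)) b H j → load b (filter P? H) j ℕ.≤ load b H j
  load-filter-≤ P? b []      j = z≤n
  load-filter-≤ P? b (p ∷ H) j with does (P? p)
  ... | true  = ℕ.+-monoʳ-≤ _ (load-filter-≤ P? b H j)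
  ... | false = ℕ.≤-trans (load-filter-≤ P? b H j) (ℕ.m≤n+m _ _)

  All-blocks : ∀ {Q : ℕ → Set} ps → Q 0 → All (Q ∘ proj₂) ps → All (Q ∘ proj₂) (blocks (const 0) ps)
  All-blocks []       q0 []       = []
  All-blocks (_ ∷ ps) q0 (q ∷ qs) = All.++⁺ (All-blocks ps q0 qs) (q ∷ q0 ∷ [])

  load-blocks-++ : ∀ b ps qs j → load b (blocks (const 0) (ps ++ qs)) j ≡
                                 load b (blocks (const 0) qs) j ℕ.+ load b (blocks (const 0) ps) j
  load-blocks-++ b []             qs j = sym (ℕ.+-identityʳ _)
  load-blocks-++ b ((i , c) ∷ ps) qs j
    rewrite load-++ b (blocks (const 0) (ps ++ qs)) (pair (const 0) i c) j
          | load-++ b (blocks (const 0) ps) (pair (const 0) i c) j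
          | load-blocks-++ b ps qs j = ℕ.+-assoc (load b (blocks (const 0) qs) j) _ _

  load-tinys-0 : ∀ n j → load 0 (tinys (replicate n 0)) j ≡ n
  load-tinys-0 zero    j = refl
  load-tinys-0 (suc n) j rewrite load-++ 0 (tinys (replicate n 0)) [ (tiny , 0) ] j | load-tinys-0 n j = ℕ.+-comm n 1

  All-tinys : ∀ {Q : ℕ → Set} n → Q 0 → All (Q ∘ proj₂) (tinys (replicate n 0))
  All-tinys zero    q0 = []
  All-tinys (suc n) q0 = All.++⁺ (All-tinys n q0) (q0 ∷ [])

  load-fillers : ∀ ps j → All (λ p → proj₂ p ≢ 0) ps → load 0 (blocks (const 0) ps) j ≡ length ps ℕ.* (2 ℕ.* d)
  load-fillers []             j []         = refl
  load-fillers ((i , c) ∷ ps) j (c≢0 ∷ ≢0)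
    rewrite load-++ 0 (blocks (const 0) ps) (pair (const 0) i c) j
          | load-miss (large i) [ (filler , 0) ] j c≢0
          | load-fillers ps j ≢0
          | ℕ.+-identityʳ (2 ℕ.* d) = ℕ.+-comm (length ps ℕ.* (2 ℕ.* d)) (2 ℕ.* d)

  -- One large item per listed coordinate, all in one bin. The shift by one reserves bin 0 for
  -- fillers and tiny items.
  row : ℕ → List (Fin d) → List (Fin d × ℕ)
  row m is = map (_, suc m) is

  load-row-∷ : ∀ m i is j → load (suc m) (blocks (const 0) (row m (i ∷ is))) j ≡
                            units (large i) j ℕ.+ load (suc m) (blocks (const 0) (row m is)) j
  load-row-∷ m i is j
    rewrite load-++ (suc m) (blocks (const 0) (row m is)) (pair (const 0) i (suc m)) j
          | load-hit (suc m) (large i) [ (filler , 0) ] j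
          | ℕ.+-identityʳ (units (large i) j) = ℕ.+-comm (load (suc m) (blocks (const 0) (row m is)) j) _

  load-row-∉ : ∀ m is j → j ∉ is → load (suc m) (blocks (const 0) (row m is)) j ≡ 2 ℕ.* length is
  load-row-∉ m []       j j∉ = refl
  load-row-∉ m (i ∷ is) j j∉
    rewrite load-row-∷ m i is j | load-row-∉ m is j (j∉ ∘ there) with i Fin.≟ j
  ... | yes refl = ⊥-elim (j∉ (here refl))
  ... | no _     = sym (ℕ.*-suc 2 (length is))

  -- In a duplicate-free list at most one item has its large coordinate at `j`; every other one adds
  -- 2. The bound is 2 above the true maximum, which makes the induction uniform.
  load-row-≤ : ∀ m is j → Unique is → load (suc m) (blocks (const 0) (row m is)) j ℕ.≤ a ℕ.+ 2 ℕ.* length is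
  load-row-≤ m []       j u = z≤n
  load-row-≤ m (i ∷ is) j uu@(_ ∷ u) rewrite load-row-∷ m i is j with i Fin.≟ j
  ... | yes refl rewrite load-row-∉ m is i (Unique[x∷xs]⇒x∉xs uu) =
    ℕ.+-monoʳ-≤ a (ℕ.*-monoʳ-≤ 2 (ℕ.n≤1+n (length is)))
  ... | no _ = begin
    2 ℕ.+ load (suc m) (blocks (const 0) (row m is)) j  ≤⟨ ℕ.+-monoʳ-≤ 2 (load-row-≤ m is j u) ⟩
    2 ℕ.+ (a ℕ.+ 2 ℕ.* length is)                       ≡⟨ ℕ.+-assoc 2 a _ ⟨
    2 ℕ.+ a ℕ.+ 2 ℕ.* length is                         ≡⟨ cong (ℕ._+ 2 ℕ.* length is) (ℕ.+-comm 2 a) ⟩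
    a ℕ.+ 2 ℕ.+ 2 ℕ.* length is                         ≡⟨ ℕ.+-assoc a 2 _ ⟩
    a ℕ.+ (2 ℕ.+ 2 ℕ.* length is)                       ≡⟨ cong (a ℕ.+_) (ℕ.*-suc 2 (length is)) ⟨
    a ℕ.+ 2 ℕ.* suc (length is)                         ∎
    where open ℕ.≤-Reasoning

  grid : ℕ → List (Fin d × ℕ)
  grid zero    = []
  grid (suc k) = row k (allFin d) ++ grid k

  length-grid : ∀ k → length (grid k) ≡ k ℕ.* d
  length-grid zero    = refl
  length-grid (suc k) = trans (length-++ (row k (allFin d)))
    (cong₂ ℕ._+_ (trans (length-map _ (allFin d)) (length-tabulate id)) (length-grid k))

  All-grid : ∀ {Q : ℕ → Set} k → (∀ {m} → m ℕ.< k → Q (suc m)) → All (Q ∘ proj₂) (grid k)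
  All-grid zero    q = []
  All-grid (suc k) q = All.++⁺ (All.map⁺ (All.universal (λ _ → q ℕ.≤-refl) (allFin d)))
                               (All-grid k (λ m<k → q (ℕ.m≤n⇒m≤1+n m<k)))

  -- Different rows use different nonzero bins, so only row `m` contributes to bin `suc m`.
  load-grid-≤ : ∀ m k j → load (suc m) (blocks (const 0) (grid k)) j ℕ.≤ a ℕ.+ 2 ℕ.* d
  load-grid-≤ m zero    j = z≤n
  load-grid-≤ m (suc k) j rewrite load-blocks-++ (suc m) (row k (allFin d)) (grid k) j with k ℕ.≟ m
  ... | yes refl
    rewrite load-none (blocks (const 0) (grid m)) j
              (All-blocks {_≢ suc m} (grid m) (λ ()) (All-grid m λ l<m l≡m → ℕ.<⇒≢ l<m (ℕ.suc-injective l≡m))) =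
    ℕ.≤-trans (load-row-≤ m (allFin d) j (allFin⁺ d))
              (ℕ.≤-reflexive (cong (λ n → a ℕ.+ 2 ℕ.* n) (length-tabulate {n = d} id)))
  ... | no k≢m
    rewrite load-none (blocks (const 0) (row k (allFin d))) j
              (All-blocks {_≢ suc m} (row k (allFin d)) (λ ())
                (All.map⁺ (All.universal (λ _ → k≢m ∘ ℕ.suc-injective) (allFin d))))
          | ℕ.+-identityʳ (load (suc m) (blocks (const 0) (grid k)) j) = load-grid-≤ m k j

  offline : ℕ → Packing
  offline k = blocks (const 0) (grid k) ++ tinys (replicate (k ℕ.* d) 0)

  module _ (k : ℕ) (room : k ℕ.* d ℕ.* (2 ℕ.* d) ℕ.+ k ℕ.* d ℕ.≤ a) where

    -- There are two budgets: the left side of `room` is exactly the load of bin 0, with kd fillers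
    -- and kd tiny items, while every other bin carries at most one row of large items.
    load-offline-≤ : ∀ b j → load b (offline k) j ℕ.≤ N
    load-offline-≤ zero j
      rewrite load-++ 0 (blocks (const 0) (grid k)) (tinys (replicate (k ℕ.* d) 0)) j
            | load-fillers (grid k) j (All-grid {_≢ 0} k (λ _ ()))
            | load-tinys-0 (k ℕ.* d) j | length-grid k =
      ℕ.≤-trans room (ℕ.m≤n⇒m≤1+n (ℕ.m≤m+n a (2 ℕ.* d)))
    load-offline-≤ (suc m) j
      rewrite load-++ (suc m) (blocks (const 0) (grid k)) (tinys (replicate (k ℕ.* d) 0)) j
            | load-none (tinys (replicate (k ℕ.* d) 0)) j (All-tinys {_≢ suc m} (k ℕ.* d) (λ ()))
            | ℕ.+-identityʳ (load (suc m) (blocks (const 0) (grid k)) j) = ℕ.m≤n⇒m≤1+n (load-grid-≤ m k j)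

    OPTat-≤-suc : ∀ t → OPTat (items (offline k)) t ℕ.≤ suc k
    OPTat-≤-suc t = OPTat-≤ t (offline k)
      (All.filter⁺ (active? t)
        (All.++⁺ (All-blocks {ℕ._< suc k} (grid k) (s≤s z≤n) (All-grid k s≤s)) (All-tinys (k ℕ.* d) (s≤s z≤n))))
      (λ {b} _ j → ℕ.≤-trans (load-filter-≤ (active? t) b (offline k) j) (load-offline-≤ b j))

    -- Active intervals are half-open, so at time 1 the first wave is already gone and bin 0 holds
    -- everything that remains.
    OPTat-1 : OPTat (items (offline k)) 1ℚ ℕ.≤ 1
    OPTat-1 = OPTat-≤ 1ℚ (offline k)
      (subst (All (λ p → proj₂ p ℕ.< 1)) (sym only-tinys)
        (All.filter⁺ (active? 1ℚ) (All-tinys (k ℕ.* d) (s≤s z≤n))))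
      (λ {b} _ j → ℕ.≤-trans (load-filter-≤ (active? 1ℚ) b (offline k) j) (load-offline-≤ b j))
      where
        early-inactive : ∀ p → Early p → ¬ Active 1ℚ p
        early-inactive (large _ , _) _   ()
        early-inactive (filler , _)  _   ()
        early-inactive (tiny , _)    s≡0 _ = <⇒≢ 0<s (sym s≡0)

        only-tinys : filter (active? 1ℚ) (offline k) ≡ filter (active? 1ℚ) (tinys (replicate (k ℕ.* d) 0))
        only-tinys = trans (filter-++ (active? 1ℚ) (blocks (const 0) (grid k)) _)
          (cong (_++ filter (active? 1ℚ) (tinys (replicate (k ℕ.* d) 0)))
            (filter-none (active? 1ℚ) (All.map (λ {p} → early-inactive p) (blocks-early (const 0) (grid k)))))

  -- Spans and the offline optimum as integrals

  integrate-endpoints : ∀ {X Y : Instance d} {x y} f → All (Interval 0ℚ 1ℚ) X → All (Interval s e) Y →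
                        x ∈ X → y ∈ Y →
                        integrate (endpoints (X ++ Y)) f ≡ s * f 0ℚ + (1ℚ - s) * f s + (e - 1ℚ) * f 1ℚ
  integrate-endpoints {x ∷ X} {y ∷ Y} f (p ∷ ps) (q ∷ qs) _ _ =
    integrate-steps (endpoints (x ∷ X ++ y ∷ Y)) f (dedup-early-late x X y Y p ps q qs)

  early-interval : ∀ p → Early p → Interval 0ℚ 1ℚ (toItem (proj₁ p))
  early-interval (large _ , _) _   = refl , refl
  early-interval (filler , _)  _   = refl , refl
  early-interval (tiny , _)    s≡0 = ⊥-elim (<⇒≢ 0<s (sym s≡0))

  late-interval : ∀ p → Late p → Interval s e (toItem (proj₁ p))
  late-interval (large _ , _) 0≡s = ⊥-elim (<⇒≢ 0<s 0≡s)
  late-interval (filler , _)  0≡s = ⊥-elim (<⇒≢ 0<s 0≡s)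
  late-interval (tiny , _)    _   = refl , refl

  items-intervals : ∀ {P : Kind d × ℕ → Set} {Q : Item d → Set} → (∀ p → P p → Q (toItem (proj₁ p))) →
                    ∀ {H} → All P H → All Q (items H)
  items-intervals f ps = All.map⁺ (All.map (λ {p} → f p) ps)

  -- The early item covers [0, 1) and the late one [s, e). As s < 1 these overlap, so the busy
  -- indicator is 1 on all three steps.
  span-items : ∀ {G H p q} → All Early G → All Late H → p ∈ G → q ∈ H → span (items (G ++ H)) ≡ e
  span-items {G} {H} {p} {q} early late p∈ q∈ = trans
    (cong (λ R → integrate (endpoints R) busy) (map-++ (toItem ∘ proj₁) G H))
    (trans (integrate-endpoints {X = items G} {items H} busy
              (items-intervals {Early} early-interval early) (items-intervals {Late} late-interval late)
              (∈-map⁺ _ p∈) (∈-map⁺ _ q∈))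
           total)
    where
      busy : ℚ → ℚ
      busy t = if any (activeᵇ t) (items (G ++ H)) then 1ℚ else 0ℚ

      busy-1 : ∀ t {r} → r ∈ G ++ H → Active t r → busy t ≡ 1ℚ
      busy-1 t r∈ act rewrite any-true (activeᵇ t) (∈-map⁺ (toItem ∘ proj₁) r∈) act = refl

      total : s * busy 0ℚ + (1ℚ - s) * busy s + (e - 1ℚ) * busy 1ℚ ≡ e
      total
        rewrite busy-1 0ℚ (∈-++⁺ˡ p∈) (early-active-0 p (All.lookup early p∈))
              | busy-1 s (∈-++⁺ˡ p∈) (early-active-s p (All.lookup early p∈))
              | busy-1 1ℚ (∈-++⁺ʳ G q∈) (late-active (<⇒≤ s<1) 1<e q (All.lookup late q∈)) =
        solve 2 (λ s e → s :* con 1ℚ :+ (con 1ℚ :- s) :* con 1ℚ :+ (e :- con 1ℚ) :* con 1ℚ := e) refl s e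
        where open +-*-Solver

  items-blocks : ∀ {g h} ps qs → map proj₁ ps ≡ map proj₁ qs → items (blocks g ps) ≡ items (blocks h qs)
  items-blocks []             []             _  = refl
  items-blocks {g} {h} ((i , b) ∷ ps) ((j , c) ∷ qs) eq with ∷-injective eq
  ... | refl , eq′ = begin
    items (blocks g ps ++ pair g i b)          ≡⟨ map-++ _ (blocks g ps) _ ⟩
    items (blocks g ps) ++ items (pair h i c)  ≡⟨ cong (_++ _) (items-blocks ps qs eq′) ⟩
    items (blocks h qs) ++ items (pair h i c)  ≡⟨ map-++ _ (blocks h qs) _ ⟨
    items (blocks h qs ++ pair h i c)          ∎
    where open ≡-Reasoning

  items-tinys : ∀ bs cs → length bs ≡ length cs → items (tinys bs) ≡ items (tinys cs)
  items-tinys []       []       _  = refl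
  items-tinys (b ∷ bs) (c ∷ cs) eq = begin
    items (tinys bs ++ [ (tiny , b) ])         ≡⟨ map-++ _ (tinys bs) _ ⟩
    items (tinys bs) ++ [ toItem tiny ]        ≡⟨ cong (_++ _) (items-tinys bs cs (ℕ.suc-injective eq)) ⟩
    items (tinys cs) ++ [ toItem tiny ]        ≡⟨ map-++ _ (tinys cs) _ ⟨
    items (tinys cs ++ [ (tiny , c) ])         ∎
    where open ≡-Reasoning

  -- Online and offline packings differ in labels only, so the cost bound and the bound on `OPT`
  -- concern the same instance.
  items-offline : ∀ k ps cs → map proj₁ ps ≡ map proj₁ (grid k) → length cs ≡ k ℕ.* d →
                  items (blocks id ps ++ tinys cs) ≡ items (offline k)
  items-offline k ps cs eq len = begin
    items (blocks id ps ++ tinys cs)               ≡⟨ map-++ _ (blocks id ps) _ ⟩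
    items (blocks id ps) ++ items (tinys cs)       ≡⟨ cong₂ _++_ (items-blocks ps (grid k) eq)
                                                        (items-tinys cs (replicate (k ℕ.* d) 0) (trans len (sym (length-replicate (k ℕ.* d))))) ⟩
    items (blocks (const 0) (grid k)) ++ items (tinys (replicate (k ℕ.* d) 0)) ≡⟨ map-++ _ (blocks (const 0) (grid k)) _ ⟨
    items (offline k)                              ∎
    where open ≡-Reasoning

  module _ (k : ℕ) (0<k : 0 ℕ.< k) (0<d : 0 ℕ.< d) where

    large-∈ : ∃ λ p → p ∈ blocks (const 0) (grid k)
    large-∈ = first k 0<k d 0<d refl
      where
        last : ∀ qs → 0 ℕ.< length qs → ∃ λ p → p ∈ blocks (const 0) qs
        last ((i , c) ∷ qs) _ = _ , ∈-++⁺ʳ (blocks (const 0) qs) (here refl)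

        first : ∀ k → 0 ℕ.< k → ∀ n → 0 ℕ.< n → n ≡ d → ∃ λ p → p ∈ blocks (const 0) (grid k)
        first k 0<k n 0<n refl = last (grid k) (subst (0 ℕ.<_) (sym (length-grid k)) (ℕ.*-mono-≤ 0<k 0<n))

    tiny-∈ : ∃ λ p → p ∈ tinys (replicate (k ℕ.* d) 0)
    tiny-∈ = last (k ℕ.* d) (ℕ.*-mono-≤ 0<k 0<d)
      where
        last : ∀ n → 0 ℕ.< n → ∃ λ p → p ∈ tinys (replicate n 0)
        last (suc n) _ = _ , ∈-++⁺ʳ (tinys (replicate n 0)) (here refl)

    OPT-offline : let v t = ℕ→ℚ (OPTat (items (offline k)) t) in
                  OPT (items (offline k)) ≡ s * v 0ℚ + (1ℚ - s) * v s + (e - 1ℚ) * v 1ℚ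
    OPT-offline = trans
      (cong (λ R → integrate (endpoints R) (λ t → ℕ→ℚ (OPTat (items (offline k)) t)))
        (map-++ (toItem ∘ proj₁) (blocks (const 0) (grid k)) (tinys (replicate (k ℕ.* d) 0))))
      (integrate-endpoints {X = items (blocks (const 0) (grid k))} {items (tinys (replicate (k ℕ.* d) 0))} _
        (items-intervals {Early} early-interval (blocks-early (const 0) (grid k)))
        (items-intervals {Late} late-interval (tinys-late (replicate (k ℕ.* d) 0)))
        (∈-map⁺ _ (proj₂ large-∈)) (∈-map⁺ _ (proj₂ tiny-∈)))

    0≤s = <⇒≤ 0<s
    0≤1-s = p≤q⇒0≤q-p (<⇒≤ s<1)
    0≤e-1 = p≤q⇒0≤q-p (<⇒≤ 1<e)

    weighted : ℕ → ℕ → ℕ → ℚ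
    weighted l m n = s * ℕ→ℚ l + (1ℚ - s) * ℕ→ℚ m + (e - 1ℚ) * ℕ→ℚ n

    weighted-≤ : ∀ {l l′ m m′ n n′} → l ℕ.≤ l′ → m ℕ.≤ m′ → n ℕ.≤ n′ → weighted l m n ≤ weighted l′ m′ n′
    weighted-≤ {l} {l′} {m} {m′} {n} {n′} l≤ m≤ n≤ =
      +-mono-≤ (+-mono-≤ (*-mono-nonNeg {s} 0≤s (ℕ→ℚ-mono-≤ l≤)) (*-mono-nonNeg {1ℚ - s} 0≤1-s (ℕ→ℚ-mono-≤ m≤)))
               (*-mono-nonNeg {e - 1ℚ} 0≤e-1 (ℕ→ℚ-mono-≤ n≤))

    -- At most k + 1 bins are needed on [0, 1) and one on [1, e), and (k + 1) + (e - 1) = k + e.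
    OPT-≤ : k ℕ.* d ℕ.* (2 ℕ.* d) ℕ.+ k ℕ.* d ℕ.≤ a → OPT (items (offline k)) ≤ ℕ→ℚ k + e
    OPT-≤ room = begin
      OPT (items (offline k)) ≡⟨ OPT-offline ⟩
      weighted (OPTat (items (offline k)) 0ℚ) (OPTat (items (offline k)) s) (OPTat (items (offline k)) 1ℚ)
        ≤⟨ weighted-≤ (OPTat-≤-suc k room 0ℚ) (OPTat-≤-suc k room s) (OPTat-1 k room) ⟩
      weighted (suc k) (suc k) 1
        ≡⟨ cong (λ x → s * x + (1ℚ - s) * x + (e - 1ℚ) * 1ℚ) (ℕ→ℚ-+ 1 k) ⟩
      s * (1ℚ + ℕ→ℚ k) + (1ℚ - s) * (1ℚ + ℕ→ℚ k) + (e - 1ℚ) * 1ℚ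
        ≡⟨ solve 3 (λ s e x → s :* (con 1ℚ :+ x) :+ (con 1ℚ :- s) :* (con 1ℚ :+ x) :+ (e :- con 1ℚ) :* con 1ℚ := x :+ e)
             refl s e (ℕ→ℚ k) ⟩
      ℕ→ℚ k + e ∎
      where
        open ≤-Reasoning
        open +-*-Solver

    0≤OPT : 0ℚ ≤ OPT (items (offline k))
    0≤OPT = begin
      0ℚ ≡⟨ solve 2 (λ s e → con 0ℚ := s :* con 0ℚ :+ (con 1ℚ :- s) :* con 0ℚ :+ (e :- con 1ℚ) :* con 0ℚ) refl s e ⟩
      weighted 0 0 0 ≤⟨ weighted-≤ {l′ = OPTat (items (offline k)) 0ℚ} {m′ = OPTat (items (offline k)) s}
                          {n′ = OPTat (items (offline k)) 1ℚ} z≤n z≤n z≤n ⟩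
      weighted (OPTat (items (offline k)) 0ℚ) (OPTat (items (offline k)) s) (OPTat (items (offline k)) 1ℚ)
        ≡⟨ OPT-offline ⟨
      OPT (items (offline k)) ∎
      where
        open ≤-Reasoning
        open +-*-Solver

  kind-duration : ∀ k {r} → r ∈ items (offline k) → duration r ≡ 1ℚ ⊎ duration r ≡ e - s
  kind-duration k r∈ with ∈-map⁻ (toItem ∘ proj₁) r∈
  ... | (large _ , _) , _ , refl = inj₁ refl
  ... | (filler  , _) , _ , refl = inj₁ refl
  ... | (tiny    , _) , _ , refl = inj₂ refl

  durationRatio : ∀ k → 0 ℕ.< k → 0 ℕ.< d → 1ℚ ≤ e - s → DurationRatio (items (offline k)) (e - s)
  durationRatio k 0<k 0<d 1≤e-s =
    toItem (proj₁ rmin) , toItem (proj₁ rmax) ,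
    ∈-map⁺ (toItem ∘ proj₁) (∈-++⁺ˡ rmin∈) , ∈-map⁺ (toItem ∘ proj₁) (∈-++⁺ʳ (blocks (const 0) (grid k)) rmax∈) ,
    (λ r r∈ → between r (kind-duration k r∈)) ,
    trans dmax (sym (trans (cong ((e - s) *_) dmin) (*-identityʳ (e - s))))
    where
      rmin  = proj₁ (large-∈ k 0<k 0<d)
      rmin∈ = proj₂ (large-∈ k 0<k 0<d)
      rmax  = proj₁ (tiny-∈ k 0<k 0<d)
      rmax∈ = proj₂ (tiny-∈ k 0<k 0<d)

      dmin : duration (toItem (proj₁ rmin)) ≡ 1ℚ
      dmin with early-interval rmin (All.lookup (blocks-early (const 0) (grid k)) rmin∈)
      ... | p , q = cong₂ _-_ q p

      dmax : duration (toItem (proj₁ rmax)) ≡ e - s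
      dmax with late-interval rmax (All.lookup (tinys-late (replicate (k ℕ.* d) 0)) rmax∈)
      ... | p , q = cong₂ _-_ q p

      between : ∀ r → duration r ≡ 1ℚ ⊎ duration r ≡ e - s →
                duration (toItem (proj₁ rmin)) ≤ duration r × duration r ≤ duration (toItem (proj₁ rmax))
      between r (inj₁ eq) = ≤-reflexive (trans dmin (sym eq)) , subst₂ _≤_ (sym eq) (sym dmax) 1≤e-s
      between r (inj₂ eq) = subst₂ _≤_ (sym dmin) (sym eq) 1≤e-s , ≤-reflexive (trans eq (sym dmax))

  -- The forced run of an Any Fit algorithm

  module Run (A : Alg d) (anyFit : AnyFit A) where

    -- The bins recorded in H are the ones chosen by A.
    Consistent : Packing → Set
    Consistent H = zip (items H) (labels A (items H)) ≡ history H

    next : Packing → Kind d → ℕ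
    next H κ = choose A (items H) (toItem κ)

    _◂_ : Packing → Kind d → Packing
    H ◂ κ = H ++ [ (κ , next H κ) ]

    -- As long as no item has departed, a bin is open exactly when it occurs in `bins H`, so the Any
    -- Fit rule becomes a statement about membership and loads in ℕ.
    Forced : Packing → Kind d → Set
    Forced H κ = (next H κ ∈ bins H → Fits (next H κ) H κ) ×
                 (next H κ ∉ bins H → ∀ {b} → b ∈ bins H → ¬ Fits b H κ)

    consistent-◂ : ∀ H κ → Consistent H → Consistent (H ◂ κ)
    consistent-◂ H κ con
      rewrite map-++ (toItem ∘ proj₁) H [ (κ , next H κ) ]
            | zip-labelsFrom-snoc A [] (items H) (toItem κ)
            | con = sym (map-++ _ H [ (κ , next H κ) ])

    forced : ∀ H κ → ValidInstance (items (H ◂ κ)) → All (Active (start κ)) H → Consistent H → Forced H κ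
    forced H κ valid active con
      -- The rule is applied to the instance cut off right after the arriving item, which carries
      -- the same history.
      with anyFit (items (H ◂ κ)) valid (items H) (toItem κ) [] (map-++ (toItem ∘ proj₁) H [ (κ , next H κ) ])
    ... | _ , fits , new rewrite con = old-fits , new-none
      where
        old-fits : next H κ ∈ bins H → Fits (next H κ) H κ
        old-fits b∈ = leq1-scaled⁻ _ (trans (sym (fitsᵇ-history _ H κ active)) (fits (∈⇒open (start κ) H active b∈)))

        new-none : next H κ ∉ bins H → ∀ {b} → b ∈ bins H → ¬ Fits b H κ
        new-none b∉ {b} b∈ fit with trans (sym (new (∉⇒unused H b∉) b (∈⇒open (start κ) H active b∈)))
                                          (trans (fitsᵇ-history b H κ active) (leq1-scaled fit))
        ... | ()

    early-valid : ∀ G → All Early G → ValidInstance (items G)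
    early-valid G early = subst (ValidInstance ∘ items) (++-identityʳ G) (items-valid G [] early [])

    overflow : ∀ {x y} → a ℕ.+ 2 ℕ.* d ℕ.≤ x → 2 ℕ.≤ y → ¬ (x ℕ.+ y ℕ.≤ N)
    overflow {x} {y} full 2≤y x+y≤N = ℕ.<-irrefl refl (begin-strict
      N                    <⟨ ℕ.n<1+n N ⟩
      suc N                ≡⟨ ℕ.+-comm 2 (a ℕ.+ 2 ℕ.* d) ⟩
      a ℕ.+ 2 ℕ.* d ℕ.+ 2  ≤⟨ ℕ.+-mono-≤ full 2≤y ⟩
      x ℕ.+ y              ≤⟨ x+y≤N ⟩
      N                    ∎)
      where open ℕ.≤-Reasoning

    -- Fitting is required in all coordinates, so the single full one is decisive; the items in `H`
    -- can only increase its load.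
    full-blocks-reject : ∀ {b} ps H κ → (∀ j → 2 ℕ.≤ units κ j) → b ∈ map proj₂ ps → ¬ Fits b (blocks id ps ++ H) κ
    full-blocks-reject {b} ps H κ 2≤κ b∈ fits with blocks-full ps b∈
    ... | j , full = overflow (ℕ.≤-trans full (ℕ.≤-trans (ℕ.m≤m+n _ (load b H j))
                                (ℕ.≤-reflexive (sym (load-++ b (blocks id ps) H j))))) (2≤κ j) (fits j)

    filler-fits : ∀ {b} i ps → b ∉ map proj₂ ps → Fits b (blocks id ps ++ [ (large i , b) ]) filler
    filler-fits {b} i ps b∉ j
      rewrite load-++ b (blocks id ps) [ (large i , b) ] j
            | load-absent (blocks id ps) j (b∉ ∘ bins-blocks⁻ ps)
            | load-hit b (large i) [] j
            | ℕ.+-identityʳ (units (large i) j) =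
      ℕ.m≤n⇒m≤1+n (ℕ.+-monoˡ-≤ (2 ℕ.* d) (units-large-≤ i j))

    -- The labels are up to the algorithm, hence existential; what is forced is that both items of a
    -- pair share one and that different pairs receive different ones.
    phase₁ : ∀ is → ∃ λ ps → map proj₁ ps ≡ is × Unique (map proj₂ ps) × Consistent (blocks id ps)
    phase₁ []       = [] , refl , [] , refl
    phase₁ (i ∷ is) with phase₁ is
    ... | ps , refl , u , con = (i , b) ∷ ps , refl , All.¬Any⇒All¬ _ b∉ ∷ u , con₂
      where
        H₀ = blocks id ps
        b  = next H₀ (large i)
        H₁ = H₀ ◂ large i
        b′ = next H₁ filler

        early₁ : All Early H₁
        early₁ = All.++⁺ (blocks-early id ps) (refl ∷ [])

        con₁ : Consistent H₁
        con₁ = consistent-◂ H₀ (large i) con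

        forced₀ : Forced H₀ (large i)
        forced₀ = forced H₀ (large i) (early-valid H₁ early₁) (All.map (λ {p} → early-active-0 p) (blocks-early id ps)) con

        forced₁ : Forced H₁ filler
        forced₁ = forced H₁ filler (early-valid (H₁ ◂ filler) (All.++⁺ early₁ (refl ∷ [])))
                    (All.map (λ {p} → early-active-0 p) early₁) con₁

        b∉ : b ∉ map proj₂ ps
        b∉ b∈ = full-blocks-reject ps [] (large i) (2≤units-large i) b∈
                  (subst (λ H → Fits b H (large i)) (sym (++-identityʳ H₀)) (proj₁ forced₀ (bins-blocks⁺ ps b∈)))

        -- A new bin is excluded because the bin just opened has room for the filler, and an older
        -- bin by its full coordinate.
        b′≡b : b′ ≡ b
        b′≡b with b′ ∈? bins H₁
        ... | no b′∉ = ⊥-elim (proj₂ forced₁ b′∉ (bins-++⁺ʳ H₀ [ (large i , b) ] (here refl)) (filler-fits i ps b∉))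
        ... | yes b′∈ with bins-++⁻ H₀ [ (large i , b) ] b′∈
        ...   | inj₁ b′∈ps       = ⊥-elim (full-blocks-reject ps [ (large i , b) ] filler (λ _ → 2≤2d i)
                                            (bins-blocks⁻ ps b′∈ps) (proj₁ forced₁ b′∈))
        ...   | inj₂ (here eq)   = eq

        con₂ : Consistent (H₀ ++ pair id i b)
        con₂ = subst Consistent
          (trans (++-assoc H₀ _ _) (cong (λ c → H₀ ++ (large i , b) ∷ (filler , c) ∷ []) b′≡b))
          (consistent-◂ H₁ filler con₁)

    load-tinys-hit : ∀ {b} cs j → b ∈ cs → 1 ℕ.≤ load b (tinys cs) j
    load-tinys-hit {b} (b ∷ cs) j (here refl) rewrite load-++ b (tinys cs) [ (tiny , b) ] j | load-hit b tiny [] j =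
      ℕ.m≤n+m 1 (load b (tinys cs) j)
    load-tinys-hit {b} (c ∷ cs) j (there b∈) rewrite load-++ b (tinys cs) [ (tiny , c) ] j =
      ℕ.≤-trans (load-tinys-hit cs j b∈) (ℕ.m≤m+n _ _)

    missing : ∀ {bs cs : List ℕ} → Unique bs → length cs ℕ.< length bs → ∃ λ b → b ∈ bs × b ∉ cs
    missing {bs} {cs} u lt with All.all? (_∈? cs) bs
    ... | yes all = ⊥-elim (ℕ.<⇒≱ lt (Unique-⊆⇒length-≤ u (All.lookup all)))
    ... | no ¬all = find (All.¬All⇒Any¬ (_∈? cs) bs ¬all)

    -- As long as fewer tiny items than pairs have arrived, some bin has none and still has room, so
    -- no new bin may be opened; `m ≤ length ps` guarantees such a bin.
    phase₂ : ∀ ps → Unique (map proj₂ ps) → Consistent (blocks id ps) → ∀ m → m ℕ.≤ length ps →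
             ∃ λ cs → length cs ≡ m × Unique cs × (∀ {c} → c ∈ cs → c ∈ map proj₂ ps) × Consistent (blocks id ps ++ tinys cs)
    phase₂ ps u con zero    m≤n = [] , refl , [] , (λ ()) , subst Consistent (sym (++-identityʳ _)) con
    phase₂ ps u con (suc m) m<n with phase₂ ps u con m (ℕ.<⇒≤ m<n)
    ... | cs , refl , v , cs⊆ps , con′ =
      b ∷ cs , refl , All.¬Any⇒All¬ _ b∉cs ∷ v , (λ { (here refl) → b∈ps ; (there c∈) → cs⊆ps c∈ }) ,
      subst Consistent (++-assoc (blocks id ps) (tinys cs) _) (consistent-◂ H tiny con′)
      where
        H = blocks id ps ++ tinys cs
        b = next H tiny

        forced′ : Forced H tiny
        forced′ = forced H tiny
          (subst (ValidInstance ∘ items) (sym (++-assoc (blocks id ps) (tinys cs) _))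
            (items-valid (blocks id ps) (tinys (b ∷ cs)) (blocks-early id ps) (tinys-late (b ∷ cs))))
          (All.++⁺ (All.map (λ {p} → early-active-s p) (blocks-early id ps))
                   (All.map (λ {p} → late-active ≤-refl (<-trans s<1 1<e) p) (tinys-late cs)))
          con′

        tiny-fits : ∀ {b} → b ∉ cs → Fits b H tiny
        tiny-fits {b} b∉ j
          rewrite load-++ b (blocks id ps) (tinys cs) j
                | load-absent (tinys cs) j (b∉ ∘ bins-tinys⁻ cs)
                | ℕ.+-identityʳ (load b (blocks id ps) j)
                | ℕ.+-comm (load b (blocks id ps) j) 1 = s≤s (blocks-notOver ps u j)

        b∈H : b ∈ bins H
        b∈H with b ∈? bins H
        ... | yes b∈ = b∈
        ... | no b∉ with missing u (ℕ.≤-trans m<n (ℕ.≤-reflexive (sym (length-map proj₂ ps))))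
        ...   | c , c∈ps , c∉cs =
          ⊥-elim (proj₂ forced′ b∉ (bins-++⁺ˡ (blocks id ps) (tinys cs) (bins-blocks⁺ ps c∈ps)) (tiny-fits c∉cs))

        b∈ps : b ∈ map proj₂ ps
        b∈ps with bins-++⁻ (blocks id ps) (tinys cs) b∈H
        ... | inj₁ b∈ = bins-blocks⁻ ps b∈
        ... | inj₂ b∈ = cs⊆ps (bins-tinys⁻ cs b∈)

        -- A second tiny item would raise the full coordinate from N - 1 to N + 1.
        b∉cs : b ∉ cs
        b∉cs b∈cs with blocks-full ps b∈ps
        ... | j , full = ℕ.<-irrefl refl (begin-strict
          N                                                    ≡⟨ ℕ.+-comm 1 _ ⟩
          a ℕ.+ 2 ℕ.* d ℕ.+ 1                                  ≤⟨ ℕ.+-mono-≤ full (load-tinys-hit cs j b∈cs) ⟩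
          load b (blocks id ps) j ℕ.+ load b (tinys cs) j      ≡⟨ load-++ b (blocks id ps) (tinys cs) j ⟨
          load b H j                                           <⟨ ℕ.n<1+n _ ⟩
          suc (load b H j)                                     ≡⟨ ℕ.+-comm 1 _ ⟩
          load b H j ℕ.+ 1                                     ≤⟨ proj₁ forced′ b∈H j ⟩
          N                                                    ∎)
          where open ℕ.≤-Reasoning

    -- The cost of the run

    bin-span : ∀ ps cs {b} → b ∈ map proj₂ ps → b ∈ cs →
               span (map proj₁ (filter (λ p → proj₂ p ℕ.≟ b) (history (blocks id ps ++ tinys cs)))) ≡ e
    bin-span ps cs {b} b∈ps b∈cs = trans (cong span (trans (filter-history (blocks id ps ++ tinys cs))
         (cong items (filter-++ in-b? (blocks id ps) (tinys cs)))))
      (span-items (All.filter⁺ in-b? (blocks-early id ps)) (All.filter⁺ in-b? (tinys-late cs))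
        (∈-filter⁺ in-b? {x = proj₁ (occ (bins-blocks⁺ ps b∈ps))} (proj₁ (proj₂ (occ (bins-blocks⁺ ps b∈ps)))) (proj₂ (proj₂ (occ (bins-blocks⁺ ps b∈ps)))))
        (∈-filter⁺ in-b? (tiny-in cs b∈cs) refl))
      where
        in-b? : ∀ (p : Kind d × ℕ) → Dec (proj₂ p ≡ b)
        in-b? p = proj₂ p ℕ.≟ b

        filter-history : ∀ H → map proj₁ (filter (λ p → proj₂ p ℕ.≟ b) (history H)) ≡ items (filter in-b? H)
        filter-history []            = refl
        filter-history (p ∷ H) with does (in-b? p)
        ... | true  = cong (_ ∷_) (filter-history H)
        ... | false = filter-history H

        occ : ∀ {H} → b ∈ bins H → ∃ λ p → p ∈ H × proj₂ p ≡ b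
        occ b∈ with ∈-map⁻ proj₂ b∈
        ... | p , p∈ , eq = p , p∈ , sym eq

        tiny-in : ∀ cs → b ∈ cs → (tiny , b) ∈ tinys cs
        tiny-in (c ∷ cs) (here refl) = ∈-++⁺ʳ (tinys cs) (here refl)
        tiny-in (c ∷ cs) (there b∈)  = ∈-++⁺ˡ (tiny-in cs b∈)

    labels-consistent : ∀ H → Consistent H → labels A (items H) ≡ bins H
    labels-consistent H con = begin
      labels A (items H)                              ≡⟨ zip-labelsFrom-proj₂ A [] (items H) ⟨
      map proj₂ (zip (items H) (labels A (items H)))  ≡⟨ cong (map proj₂) con ⟩
      map proj₂ (history H)                           ≡⟨ map-∘ H ⟨
      bins H                                          ∎
      where open ≡-Reasoning

    cost-≥ : ∀ ps cs → Unique (map proj₂ ps) → Unique cs → length cs ≡ length ps →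
             (∀ {c} → c ∈ cs → c ∈ map proj₂ ps) → Consistent (blocks id ps ++ tinys cs) →
             ℕ→ℚ (length ps) * e ≤ cost A (items (blocks id ps ++ tinys cs))
    cost-≥ ps cs u v len cs⊆ps con = begin
      ℕ→ℚ (length ps) * e ≤⟨ *-monoʳ-≤-nonNeg e {{nonNegative (<⇒≤ (<-trans 0<s (<-trans s<1 1<e)))}} (ℕ→ℚ-mono-≤ count) ⟩
      ℕ→ℚ (length used) * e ≡⟨ sumℚ-const _ e used spans ⟨
      sumℚ (map (λ b → span (map proj₁ (filter (λ p → proj₂ p ℕ.≟ b) (history H)))) used)
        ≡⟨ cong₂ (λ Z L → sumℚ (map (λ b → span (map proj₁ (filter (λ p → proj₂ p ℕ.≟ b) Z))) (deduplicate ℕ._≟_ L)))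
             con (labels-consistent H con) ⟨
      cost A (items H) ∎
      where
        open ≤-Reasoning
        H = blocks id ps ++ tinys cs
        used = deduplicate ℕ._≟_ (bins H)

        -- The inclusion of `cs` in the bins of the pairs is reversed by counting: a bin missing
        -- from `cs` could be prepended to it, giving a duplicate-free list longer than the list
        -- containing it.
        ps⊆cs : ∀ {b} → b ∈ map proj₂ ps → b ∈ cs
        ps⊆cs {b} b∈ with b ∈? cs
        ... | yes b∈cs = b∈cs
        ... | no b∉cs = ⊥-elim (ℕ.<⇒≱
          (Unique-⊆⇒length-≤ (All.¬Any⇒All¬ _ b∉cs ∷ v) (λ { (here refl) → b∈ ; (there c∈) → cs⊆ps c∈ }))
          (ℕ.≤-reflexive (trans (length-map proj₂ ps) (sym len))))

        count : length ps ℕ.≤ length used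
        count = ℕ.≤-trans (ℕ.≤-reflexive (sym (length-map proj₂ ps)))
          (Unique-⊆⇒length-≤ u λ b∈ → ∈-deduplicate⁺ ℕ._≟_ (bins-++⁺ˡ (blocks id ps) (tinys cs) (bins-blocks⁺ ps b∈)))

        in-ps : ∀ {b} → b ∈ used → b ∈ map proj₂ ps
        in-ps b∈ with bins-++⁻ (blocks id ps) (tinys cs) (∈-deduplicate⁻ ℕ._≟_ (bins H) b∈)
        ... | inj₁ b∈′ = bins-blocks⁻ ps b∈′
        ... | inj₂ b∈′ = cs⊆ps (bins-tinys⁻ cs b∈′)

        spans : ∀ {b} → b ∈ used → span (map proj₁ (filter (λ p → proj₂ p ℕ.≟ b) (history H))) ≡ e
        spans b∈ = bin-span ps cs (in-ps b∈) (ps⊆cs (in-ps b∈))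

    cost-offline : ∀ k → ℕ→ℚ (k ℕ.* d) * e ≤ cost A (items (offline k))
    cost-offline k with phase₁ (map proj₁ (grid k))
    ... | ps , eq , u , con with phase₂ ps u con (length ps) ℕ.≤-refl
    ... | cs , len , v , cs⊆ps , con′ = subst₂ (λ n S → ℕ→ℚ n * e ≤ cost A S) length-ps
      (items-offline k ps cs eq (trans len length-ps)) (cost-≥ ps cs u v len cs⊆ps con′)
      where
        length-ps : length ps ≡ k ℕ.* d
        length-ps = trans (sym (length-map proj₁ ps)) (trans (cong length eq) (trans (length-map proj₁ (grid k)) (length-grid k)))

    hard-instance : ∀ k → 0 ℕ.< k → 0 ℕ.< d → k ℕ.* d ℕ.* (2 ℕ.* d) ℕ.+ k ℕ.* d ℕ.≤ a → 1ℚ ≤ e - s →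
                    ∃ λ R → ValidInstance R × DurationRatio R (e - s) ×
                            0ℚ ≤ OPT R × OPT R ≤ ℕ→ℚ k + e × ℕ→ℚ (k ℕ.* d) * e ≤ cost A R
    hard-instance k 0<k 0<d room 1≤e-s =
      items (offline k) ,
      items-valid (blocks (const 0) (grid k)) (tinys (replicate (k ℕ.* d) 0))
        (blocks-early (const 0) (grid k)) (tinys-late (replicate (k ℕ.* d) 0)) ,
      durationRatio k 0<k 0<d 1≤e-s , 0≤OPT k 0<k 0<d , OPT-≤ k 0<k 0<d room , cost-offline k

-- Choice of the parameters

lower-bound : ∀ {d k τ μ δ} → 0 ℕ.< d → 0 ℕ.< k → 0ℚ < τ → τ < 1ℚ → 1ℚ ≤ μ → 0ℚ ≤ δ → ℕ→ℚ k * τ ≡ 1ℚ →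
              ℕ→ℚ d * ((μ + 1ℚ) * (μ + 1ℚ) + 1ℚ) ≤ δ * ℕ→ℚ k →
              (A : Alg d) → AnyFit A →
              ∃ λ (R : Instance d) → ValidInstance R × DurationRatio R μ
                × ((((μ + 1ℚ) * ℕ→ℚ d) - δ) * OPT R ≤ cost A R)
lower-bound {d} {k} {τ} {μ} {δ} 0<d 0<k 0<τ τ<1 1≤μ 0≤δ Kτ≡1 enough A anyFit =
  -- The value `2 ℕ.+ room` for `a` meets both demands on it: at least 2, and large enough for bin
  -- 0.
  conclude (Gadget.Run.hard-instance d (2 ℕ.+ room) (ℕ.m≤m+n 2 room) s e 0<s s<1 1<e A anyFit
              k 0<k 0<d (ℕ.m≤n+m room 2) (subst (1ℚ ≤_) (sym e-s≡μ) 1≤μ))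
  where
    open +-*-Solver

    room : ℕ
    room = k ℕ.* d ℕ.* (2 ℕ.* d) ℕ.+ k ℕ.* d

    M s e : ℚ
    M = μ + 1ℚ
    s = 1ℚ - τ
    e = s + μ

    0<s : 0ℚ < s
    0<s = p<q⇒0<q-p τ<1

    s<1 : s < 1ℚ
    s<1 = subst (s <_) (+-identityʳ 1ℚ) (+-monoʳ-< 1ℚ (neg-antimono-< 0<τ))

    1<e : 1ℚ < e
    1<e = +-mono-<-≤ 0<s 1≤μ

    0≤M : 0ℚ ≤ M
    0≤M = ≤-trans (*≤* (ℤ.+≤+ z≤n)) (+-monoˡ-≤ 1ℚ 1≤μ)

    e-s≡μ : e - s ≡ μ
    e-s≡μ = solve 2 (λ s μ → s :+ μ :- s := μ) refl s μ

    e≡M-τ : e ≡ M - τ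
    e≡M-τ = solve 2 (λ μ τ → con 1ℚ :- τ :+ μ := μ :+ con 1ℚ :- τ) refl μ τ

    kd*e : ℕ→ℚ (k ℕ.* d) * e ≡ ℕ→ℚ k * ℕ→ℚ d * (M - τ)
    kd*e = cong₂ _*_ (ℕ→ℚ-* k d) e≡M-τ

    0≤kd*e : 0ℚ ≤ ℕ→ℚ (k ℕ.* d) * e
    0≤kd*e = subst (_≤ ℕ→ℚ (k ℕ.* d) * e) (*-zeroˡ e)
      (*-monoʳ-≤-nonNeg e {{nonNegative (<⇒≤ (<-trans 0<s (<-trans s<1 1<e)))}} (ℕ→ℚ-mono-≤ {0} {k ℕ.* d} z≤n))

    conclude : (∃ λ (R : Instance d) → ValidInstance R × DurationRatio R (e - s) ×
                 0ℚ ≤ OPT R × OPT R ≤ ℕ→ℚ k + e × ℕ→ℚ (k ℕ.* d) * e ≤ cost A R) →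
               ∃ λ (R : Instance d) → ValidInstance R × DurationRatio R μ × ((M * ℕ→ℚ d) - δ) * OPT R ≤ cost A R
    conclude (R , valid , durations , 0≤OPT , OPT≤ , ≤cost) =
      R , valid , subst (DurationRatio R) e-s≡μ durations ,
      competitive {M} {ℕ→ℚ d} {ℕ→ℚ k} {δ} {τ} 0≤M 0≤δ (<⇒≤ 0<τ) (subst (0ℚ ≤_) kd*e 0≤kd*e) Kτ≡1 enough 0≤OPT
        (subst (λ x → OPT R ≤ ℕ→ℚ k + x) e≡M-τ OPT≤) (subst (_≤ cost A R) kd*e ≤cost)

theorem4 : (d : ℕ) → 1 ≤ℕ d → (μ : ℚ) → 1ℚ ≤ μ →
    (A : Alg d) → AnyFit A →
    (δ : ℚ) → 0ℚ < δ →
    ∃ λ (R : Instance d) → ValidInstance R × DurationRatio R μ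
    × ((((μ + 1ℚ) * ℕ→ℚ d) - δ) * OPT R ≤ cost A R)
-- The threshold for δk pays for two losses: d(μ + 1)² covers the summand e < μ + 1 in the bound on
-- `OPT`, and d is the cost kdτ lost because e is τ = 1/k below μ + 1.
theorem4 d 1≤d μ 1≤μ A anyFit δ 0<δ = fromThreshold (archimedean-* (ℕ→ℚ d * ((μ + 1ℚ) * (μ + 1ℚ) + 1ℚ)) 0<δ)
  where
    Result : Set
    Result = ∃ λ (R : Instance d) → ValidInstance R × DurationRatio R μ × ((((μ + 1ℚ) * ℕ→ℚ d) - δ) * OPT R ≤ cost A R)

    fromReciprocal : ∀ k → 1 ℕ.< k → ℕ→ℚ d * ((μ + 1ℚ) * (μ + 1ℚ) + 1ℚ) ≤ δ * ℕ→ℚ k →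
                     (∃ λ τ → 0ℚ < τ × τ < 1ℚ × ℕ→ℚ k * τ ≡ 1ℚ) → Result
    fromReciprocal k 1<k enough (τ , 0<τ , τ<1 , Kτ≡1) =
      lower-bound {d} {k} {τ} {μ} {δ} 1≤d (ℕ.<⇒≤ 1<k) 0<τ τ<1 1≤μ (<⇒≤ 0<δ) Kτ≡1 enough A anyFit

    fromThreshold : (∃ λ k → 1 ℕ.< k × ℕ→ℚ d * ((μ + 1ℚ) * (μ + 1ℚ) + 1ℚ) ≤ δ * ℕ→ℚ k) → Result
    fromThreshold (k , 1<k , enough) = fromReciprocal k 1<k enough (reciprocal (ℕ→ℚ-mono-< 1<k))
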